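{- Let $\ell_1,\dots,\ell_n$ be a sequence of $n$ doubly transitive lines through the origin with span $\mathbb{C}^d$, and let $\varphi_i\in\ell_i$ be a unit-norm representative of $\ell_i$ for each $i\in[n]$. Then: (a) There exists $\beta$ such that $|\langle\varphi_i,\varphi_j\rangle|^2=\beta$ for every $i,j\in[n]$ with $i\neq j$. (b) If $n>d$, then there exists $\alpha$ such that $\sum_{i\in[n]}\varphi_i\varphi_i^*=\alpha I$.
   Context: $[n]=\{1,\dots,n\}$. A line is a one-dimensional complex subspace of $\mathbb{C}^d$; the span of a sequence of lines is the smallest subspace containing all of them. An automorphism of a sequence of lines $\{\ell_i\}_{i\in[n]}$ in $\mathbb{C}^d$ is a permutation $\sigma\in S_n$ for which there exists a unitary $Q\in\mathrm{U}(d)$ with $Q\ell_i=\ell_{\sigma(i)}$ for every $i\in[n]$. The lines are doubly transitive if their group of automorphisms acts doubly transitively on $[n]$, i.e., for all $x_1,x_2,y_1,y_2\in[n]$ with $x_1\ne x_2$ and $y_1\ne y_2$ there is an automorphism $\sigma$ with $\sigma(x_1)=y_1$ and $\sigma(x_2)=y_2$. -}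

module Defs where

open import Algebra.Bundles.Raw using (RawRing)
import Algebra.Definitions.RawMonoid as RawMonoidDefinitions
open import Data.Fin using (Fin; _≟_)
open import Data.Fin.Permutation using (Permutation′; _⟨$⟩ʳ_)
open import Data.Nat as ℕ using (ℕ)
import Data.Nat.Properties as ℕ
open import Data.Product using (Σ; ∃-syntax; _×_; _,_)
open import Data.Rational as ℚ using (ℚ; 0ℚ; 1ℚ; ½)
import Data.Rational.Properties as ℚ
import Data.Rational.Solver as ℚ
open import Data.Vec.Functional using (Vector)
open import Level using (0ℓ) renaming (suc to lsuc)
open import Relation.Binary.PropositionalEquality
  using (_≡_; _≢_; refl; sym; trans; cong; subst)
open import Relation.Nullary using (does)
open import Relation.Unary using (Pred; _≐_)
open import Data.Bool using (if_then_else_)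

------------------------------------------------------------------------
-- Real numbers: Cauchy sequences of rationals. Two sequences denote the
-- same real when their difference tends to 0; the quotient is rendered
-- by the equivalence relation _≃_.

Eventually : (ℕ → Set) → Set
Eventually P = ∃[ N ] (∀ n → N ℕ.≤ n → P n)

record ℝ : Set where
  constructor mkℝ
  field
    seq    : ℕ → ℚ
    cauchy : ∀ ε → 0ℚ ℚ.< ε →
             ∃[ N ] (∀ m n → N ℕ.≤ m → N ℕ.≤ n → ℚ.∣ seq m ℚ.- seq n ∣ ℚ.< ε)

open ℝ public

infix 4 _≃_

_≃_ : ℝ → ℝ → Set
x ≃ y = ∀ ε → 0ℚ ℚ.< ε → Eventually (λ n → ℚ.∣ seq x n ℚ.- seq y n ∣ ℚ.< ε)

fromℚ : ℚ → ℝ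
fromℚ q = mkℝ (λ _ → q) λ ε 0<ε →
  0 , λ _ _ _ _ → subst (λ r → ℚ.∣ r ∣ ℚ.< ε) (sym (ℚ.+-inverseʳ q)) 0<ε

0ℝ 1ℝ : ℝ
0ℝ = fromℚ 0ℚ
1ℝ = fromℚ 1ℚ

module CauchyLemmas where
  open ℚ.+-*-Solver

  half-pos : ∀ {ε} → 0ℚ ℚ.< ε → 0ℚ ℚ.< ½ ℚ.* ε
  half-pos {ε} 0<ε =
    subst (ℚ._< ½ ℚ.* ε) (ℚ.*-zeroʳ ½) (ℚ.*-monoʳ-<-pos ½ 0<ε)

  half+half : ∀ ε → ½ ℚ.* ε ℚ.+ ½ ℚ.* ε ≡ ε
  half+half ε = trans (sym (ℚ.*-distribʳ-+ ε ½ ½)) (ℚ.*-identityˡ ε)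

  open ℚ.≤-Reasoning

  opaque
    +-cauchy : ∀ x y ε → 0ℚ ℚ.< ε → ∃[ N ] (∀ m n → N ℕ.≤ m → N ℕ.≤ n →
      ℚ.∣ (seq x m ℚ.+ seq y m) ℚ.- (seq x n ℚ.+ seq y n) ∣ ℚ.< ε)
    +-cauchy x y ε 0<ε with cauchy x _ (half-pos 0<ε) | cauchy y _ (half-pos 0<ε)
    ... | N , p | M , q = N ℕ.⊔ M , λ m n m≥ n≥ →
      let a = seq x m ; b = seq y m ; c = seq x n ; d = seq y n in begin-strict
      ℚ.∣ (a ℚ.+ b) ℚ.- (c ℚ.+ d) ∣
        ≡⟨ cong ℚ.∣_∣ (solve 4 (λ a b c d →
             (a :+ b) :- (c :+ d) := (a :- c) :+ (b :- d)) refl a b c d) ⟩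
      ℚ.∣ (a ℚ.- c) ℚ.+ (b ℚ.- d) ∣
        ≤⟨ ℚ.∣p+q∣≤∣p∣+∣q∣ (a ℚ.- c) (b ℚ.- d) ⟩
      ℚ.∣ a ℚ.- c ∣ ℚ.+ ℚ.∣ b ℚ.- d ∣
        <⟨ ℚ.+-mono-< (p m n (ℕ.m⊔n≤o⇒m≤o N M m≥) (ℕ.m⊔n≤o⇒m≤o N M n≥))
                      (q m n (ℕ.m⊔n≤o⇒n≤o N M m≥) (ℕ.m⊔n≤o⇒n≤o N M n≥)) ⟩
      ½ ℚ.* ε ℚ.+ ½ ℚ.* ε ≡⟨ half+half ε ⟩
      ε ∎

  opaque
    neg-cauchy : ∀ x ε → 0ℚ ℚ.< ε → ∃[ N ] (∀ m n → N ℕ.≤ m → N ℕ.≤ n →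
      ℚ.∣ (ℚ.- seq x m) ℚ.- (ℚ.- seq x n) ∣ ℚ.< ε)
    neg-cauchy x ε 0<ε with cauchy x ε 0<ε
    ... | N , p = N , λ m n m≥ n≥ → let a = seq x m ; c = seq x n in begin-strict
      ℚ.∣ (ℚ.- a) ℚ.- (ℚ.- c) ∣
        ≡⟨ cong ℚ.∣_∣ (solve 2 (λ a c → (:- a) :- (:- c) := :- (a :- c)) refl a c) ⟩
      ℚ.∣ ℚ.- (a ℚ.- c) ∣ ≡⟨ ℚ.∣-p∣≡∣p∣ (a ℚ.- c) ⟩
      ℚ.∣ a ℚ.- c ∣       <⟨ p m n m≥ n≥ ⟩
      ε ∎

  0<1 : 0ℚ ℚ.< 1ℚ
  0<1 = ℚ.positive⁻¹ 1ℚ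

  bounded : ∀ x → ∃[ B ] (0ℚ ℚ.≤ B × Eventually (λ n → ℚ.∣ seq x n ∣ ℚ.≤ B))
  bounded x with cauchy x 1ℚ 0<1
  ... | N , p = 1ℚ ℚ.+ ℚ.∣ seq x N ∣
              , ℚ.+-mono-≤ (ℚ.<⇒≤ 0<1) (ℚ.0≤∣p∣ (seq x N))
              , N , λ n n≥ → let a = seq x n ; c = seq x N in begin
    ℚ.∣ a ∣ ≡⟨ cong ℚ.∣_∣ (solve 2 (λ a c → a := (a :- c) :+ c) refl a c) ⟩
    ℚ.∣ (a ℚ.- c) ℚ.+ c ∣     ≤⟨ ℚ.∣p+q∣≤∣p∣+∣q∣ (a ℚ.- c) c ⟩
    ℚ.∣ a ℚ.- c ∣ ℚ.+ ℚ.∣ c ∣ ≤⟨ ℚ.+-monoˡ-≤ ℚ.∣ c ∣ (ℚ.<⇒≤ (p n N n≥ ℕ.≤-refl)) ⟩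
    1ℚ ℚ.+ ℚ.∣ c ∣ ∎

  *-mono-∣∣ : ∀ {a b B δ} → ℚ.∣ a ∣ ℚ.≤ B → 0ℚ ℚ.≤ B → ℚ.∣ b ∣ ℚ.≤ δ →
              ℚ.∣ a ℚ.* b ∣ ℚ.≤ B ℚ.* δ
  *-mono-∣∣ {a} {b} {B} {δ} a≤B 0≤B b≤δ = begin
    ℚ.∣ a ℚ.* b ∣       ≡⟨ ℚ.∣p*q∣≡∣p∣*∣q∣ a b ⟩
    ℚ.∣ a ∣ ℚ.* ℚ.∣ b ∣ ≤⟨ ℚ.*-monoʳ-≤-nonNeg ℚ.∣ b ∣ {{ℚ.∣-∣-nonNeg b}} a≤B ⟩
    B ℚ.* ℚ.∣ b ∣       ≤⟨ ℚ.*-monoˡ-≤-nonNeg B {{ℚ.nonNegative 0≤B}} b≤δ ⟩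
    B ℚ.* δ ∎

  divide : ∀ C ε → 0ℚ ℚ.< C → 0ℚ ℚ.< ε → ∃[ δ ] (0ℚ ℚ.< δ × C ℚ.* δ ≡ ε)
  divide C ε 0<C 0<ε = 1/C ℚ.* ε , 0<δ , C*δ≡ε
    where
    instance
      C>0 : ℚ.Positive C
      C>0 = ℚ.positive 0<C
      C≢0 : ℚ.NonZero C
      C≢0 = ℚ.pos⇒nonZero C
    1/C : ℚ
    1/C = ℚ.1/ C
    0<δ : 0ℚ ℚ.< 1/C ℚ.* ε
    0<δ = subst (ℚ._< 1/C ℚ.* ε) (ℚ.*-zeroʳ 1/C)
            (ℚ.*-monoʳ-<-pos 1/C {{ℚ.1/pos⇒pos C}} 0<ε)
    C*δ≡ε : C ℚ.* (1/C ℚ.* ε) ≡ ε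
    C*δ≡ε = trans (sym (ℚ.*-assoc C 1/C ε))
              (trans (cong (ℚ._* ε) (ℚ.*-inverseʳ C)) (ℚ.*-identityˡ ε))

  *-difference : ∀ {a b c d A B C δ} → A ℚ.+ B ℚ.< C → 0ℚ ℚ.≤ A → 0ℚ ℚ.≤ B → 0ℚ ℚ.< δ →
    ℚ.∣ a ∣ ℚ.≤ A → ℚ.∣ d ∣ ℚ.≤ B → ℚ.∣ b ℚ.- d ∣ ℚ.< δ → ℚ.∣ a ℚ.- c ∣ ℚ.< δ →
    ℚ.∣ a ℚ.* b ℚ.- c ℚ.* d ∣ ℚ.< C ℚ.* δ
  *-difference {a} {b} {c} {d} {A} {B} {C} {δ} A+B<C 0≤A 0≤B 0<δ a≤A d≤B b-d<δ a-c<δ =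
    begin-strict
    ℚ.∣ a ℚ.* b ℚ.- c ℚ.* d ∣
      ≡⟨ cong ℚ.∣_∣ (solve 4 (λ a b c d →
           a :* b :- c :* d := a :* (b :- d) :+ d :* (a :- c)) refl a b c d) ⟩
    ℚ.∣ a ℚ.* (b ℚ.- d) ℚ.+ d ℚ.* (a ℚ.- c) ∣
      ≤⟨ ℚ.∣p+q∣≤∣p∣+∣q∣ (a ℚ.* (b ℚ.- d)) (d ℚ.* (a ℚ.- c)) ⟩
    ℚ.∣ a ℚ.* (b ℚ.- d) ∣ ℚ.+ ℚ.∣ d ℚ.* (a ℚ.- c) ∣
      ≤⟨ ℚ.+-mono-≤ (*-mono-∣∣ {a} {b ℚ.- d} a≤A 0≤A (ℚ.<⇒≤ b-d<δ))
                    (*-mono-∣∣ {d} {a ℚ.- c} d≤B 0≤B (ℚ.<⇒≤ a-c<δ)) ⟩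
    A ℚ.* δ ℚ.+ B ℚ.* δ
      ≡⟨ sym (ℚ.*-distribʳ-+ δ A B) ⟩
    (A ℚ.+ B) ℚ.* δ
      <⟨ ℚ.*-monoˡ-<-pos δ {{ℚ.positive 0<δ}} A+B<C ⟩
    C ℚ.* δ ∎

  exceeds : ∀ {A B} → 0ℚ ℚ.≤ A → 0ℚ ℚ.≤ B → ∃[ C ] (0ℚ ℚ.< C × A ℚ.+ B ℚ.< C)
  exceeds {A} {B} 0≤A 0≤B =
    1ℚ ℚ.+ (A ℚ.+ B) , ℚ.+-mono-<-≤ 0<1 (ℚ.+-mono-≤ 0≤A 0≤B) ,
    subst (ℚ._< 1ℚ ℚ.+ (A ℚ.+ B)) (ℚ.+-identityˡ (A ℚ.+ B)) (ℚ.+-monoˡ-< (A ℚ.+ B) 0<1)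

  ⊔-bounds : ∀ a b c d {k} → (a ℕ.⊔ b) ℕ.⊔ (c ℕ.⊔ d) ℕ.≤ k →
             a ℕ.≤ k × b ℕ.≤ k × c ℕ.≤ k × d ℕ.≤ k
  ⊔-bounds a b c d p =
    let ab = ℕ.m⊔n≤o⇒m≤o (a ℕ.⊔ b) (c ℕ.⊔ d) p
        cd = ℕ.m⊔n≤o⇒n≤o (a ℕ.⊔ b) (c ℕ.⊔ d) p
    in ℕ.m⊔n≤o⇒m≤o a b ab , ℕ.m⊔n≤o⇒n≤o a b ab , ℕ.m⊔n≤o⇒m≤o c d cd , ℕ.m⊔n≤o⇒n≤o c d cd

  opaque
    *-cauchy : ∀ x y ε → 0ℚ ℚ.< ε → ∃[ N ] (∀ m n → N ℕ.≤ m → N ℕ.≤ n →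
      ℚ.∣ (seq x m ℚ.* seq y m) ℚ.- (seq x n ℚ.* seq y n) ∣ ℚ.< ε)
    *-cauchy x y ε 0<ε =
      let A , 0≤A , N₁ , boundA = bounded x
          B , 0≤B , N₂ , boundB = bounded y
          C , 0<C , A+B<C       = exceeds 0≤A 0≤B
          δ , 0<δ , C*δ≡ε       = divide C ε 0<C 0<ε
          N₃ , closeX           = cauchy x δ 0<δ
          N₄ , closeY           = cauchy y δ 0<δ
      in (N₁ ℕ.⊔ N₂) ℕ.⊔ (N₃ ℕ.⊔ N₄) , λ m n m≥ n≥ →
        let m≥N₁ , _    , m≥N₃ , m≥N₄ = ⊔-bounds N₁ N₂ N₃ N₄ m≥
            _    , n≥N₂ , n≥N₃ , n≥N₄ = ⊔-bounds N₁ N₂ N₃ N₄ n≥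
        in ℚ.<-respʳ-≡ C*δ≡ε
          (*-difference {seq x m} {seq y m} {seq x n} {seq y n} A+B<C 0≤A 0≤B 0<δ
            (boundA m m≥N₁) (boundB n n≥N₂) (closeY m n m≥N₄ n≥N₄) (closeX m n m≥N₃ n≥N₃))

open CauchyLemmas using (+-cauchy; neg-cauchy; *-cauchy)

infixl 6 _+ᴿ_ _-ᴿ_
infixl 7 _*ᴿ_
infix  8 negᴿ_

_+ᴿ_ _-ᴿ_ _*ᴿ_ : ℝ → ℝ → ℝ
negᴿ_         : ℝ → ℝ
seq    (x +ᴿ y) n = seq x n ℚ.+ seq y n
cauchy (x +ᴿ y)   = +-cauchy x y
seq    (negᴿ x) n = ℚ.- seq x n
cauchy (negᴿ x)   = neg-cauchy x
seq    (x *ᴿ y) n = seq x n ℚ.* seq y n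
cauchy (x *ᴿ y)   = *-cauchy x y
x -ᴿ y = x +ᴿ negᴿ y

------------------------------------------------------------------------
-- Complex numbers

infixl 6 _+_
infixl 7 _*_
infix  8 -_
infix  4 _≈_

record ℂ : Set where
  constructor _+i_
  field
    re im : ℝ

open ℂ public

_≈_ : ℂ → ℂ → Set
z ≈ w = re z ≃ re w × im z ≃ im w

_+_ _*_ : ℂ → ℂ → ℂ
re (z + w) = re z +ᴿ re w
im (z + w) = im z +ᴿ im w
re (z * w) = re z *ᴿ re w -ᴿ im z *ᴿ im w
im (z * w) = re z *ᴿ im w +ᴿ im z *ᴿ re w

-_ conj : ℂ → ℂ
re (- z)    = negᴿ re z
im (- z)    = negᴿ im z
re (conj z) = re z
im (conj z) = negᴿ im z

0ℂ 1ℂ : ℂ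
0ℂ = 0ℝ +i 0ℝ
1ℂ = 1ℝ +i 0ℝ

∣_∣² : ℂ → ℝ
∣ z ∣² = re z *ᴿ re z +ᴿ im z *ᴿ im z

ℂ-rawRing : RawRing 0ℓ 0ℓ
ℂ-rawRing = record
  { Carrier = ℂ ; _≈_ = _≈_ ; _+_ = _+_ ; _*_ = _*_
  ; -_ = -_ ; 0# = 0ℂ ; 1# = 1ℂ }

open RawMonoidDefinitions (RawRing.+-rawMonoid ℂ-rawRing) public using (sum)

------------------------------------------------------------------------
-- The space ℂᵈ and its matrices

ℂ^_ : ℕ → Set
ℂ^ d = Vector ℂ d

Matrix : ℕ → ℕ → Set
Matrix m n = Fin m → Fin n → ℂ

infix 4 _≈ᵛ_ _≈ᵐ_

_≈ᵛ_ : ∀ {d} → ℂ^ d → ℂ^ d → Set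
u ≈ᵛ v = ∀ k → u k ≈ v k

_≈ᵐ_ : ∀ {m n} → Matrix m n → Matrix m n → Set
A ≈ᵐ B = ∀ k l → A k l ≈ B k l

0ᵛ : ∀ {d} → ℂ^ d
0ᵛ _ = 0ℂ

infixl 6 _+ᵛ_
infixl 7 _·ᵛ_ _·ᵐ_ _*ᵐ_ _*ᵐᵛ_
infix  9 _†

_+ᵛ_ : ∀ {d} → ℂ^ d → ℂ^ d → ℂ^ d
(u +ᵛ v) k = u k + v k

_·ᵛ_ : ∀ {d} → ℂ → ℂ^ d → ℂ^ d
(c ·ᵛ v) k = c * v k

linComb : ∀ {d m} → Vector ℂ m → Vector (ℂ^ d) m → ℂ^ d
linComb c v k = sum (λ i → c i * v i k)

⟨_,_⟩ : ∀ {d} → ℂ^ d → ℂ^ d → ℂ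
⟨ u , v ⟩ = sum (λ k → conj (u k) * v k)

-- ‖v‖ = √⟨v,v⟩, so ‖v‖ = 1 says exactly that ⟨v,v⟩ = 1.
UnitNorm : ∀ {d} → ℂ^ d → Set
UnitNorm v = ⟨ v , v ⟩ ≈ 1ℂ

I : ∀ {d} → Matrix d d
I k l = if does (k ≟ l) then 1ℂ else 0ℂ

_† : ∀ {m n} → Matrix m n → Matrix n m
(A †) k l = conj (A l k)

_*ᵐ_ : ∀ {m n p} → Matrix m n → Matrix n p → Matrix m p
(A *ᵐ B) k l = sum (λ j → A k j * B j l)

_*ᵐᵛ_ : ∀ {m n} → Matrix m n → ℂ^ n → ℂ^ m
(A *ᵐᵛ v) k = sum (λ j → A k j * v j)

_·ᵐ_ : ∀ {m n} → ℂ → Matrix m n → Matrix m n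
(c ·ᵐ A) k l = c * A k l

sumᵐ : ∀ {m n p} → Vector (Matrix m n) p → Matrix m n
sumᵐ A k l = sum (λ i → A i k l)

-- The rank-one matrix v v*.
outer : ∀ {d} → ℂ^ d → Matrix d d
outer v k l = v k * conj (v l)

IsUnitary : ∀ {d} → Matrix d d → Set
IsUnitary Q = Q † *ᵐ Q ≈ᵐ I × Q *ᵐ Q † ≈ᵐ I

------------------------------------------------------------------------
-- Subspaces and lines

record Subspace (d : ℕ) : Set₁ where
  field
    member      : Pred (ℂ^ d) 0ℓ
    resp-≈      : ∀ {u v : ℂ^ d} → u ≈ᵛ v → member u → member v
    0-closed    : member 0ᵛ
    +-closed    : ∀ {u v : ℂ^ d} → member u → member v → member (u +ᵛ v)
    ·-closed    : ∀ (c : ℂ) {v : ℂ^ d} → member v → member (c ·ᵛ v)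

open Subspace public using (member)

LinearlyIndependent : ∀ {d m} → Vector (ℂ^ d) m → Set
LinearlyIndependent v = ∀ c → linComb c v ≈ᵛ 0ᵛ → ∀ i → c i ≈ 0ℂ

HasDimension : ∀ {d} → Subspace d → ℕ → Set
HasDimension {d} V m = Σ (Vector (ℂ^ d) m) λ b →
  (∀ i → member V (b i)) ×
  LinearlyIndependent b ×
  (∀ v → member V v → ∃[ c ] v ≈ᵛ linComb c b)

record Line (d : ℕ) : Set₁ where
  field
    subspace : Subspace d
    dim≡1    : HasDimension subspace 1

infix 4 _∈ˡ_

_∈ˡ_ : ∀ {d} → ℂ^ d → Line d → Set
v ∈ˡ ℓ = member (Line.subspace ℓ) v

-- The smallest subspace containing all the lines, as the intersection of
-- all subspaces containing them.
span : ∀ {d n} → (Fin n → Line d) → Pred (ℂ^ d) (lsuc 0ℓ)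
span {d} ℓ v = (W : Subspace d) → (∀ i u → u ∈ˡ ℓ i → member W u) → member W v

SpanIsWholeSpace : ∀ {d n} → (Fin n → Line d) → Set₁
SpanIsWholeSpace ℓ = ∀ v → span ℓ v

image : ∀ {d} → Matrix d d → Line d → Pred (ℂ^ d) 0ℓ
image Q ℓ w = ∃[ v ] (v ∈ˡ ℓ × w ≈ᵛ Q *ᵐᵛ v)

IsAutomorphism : ∀ {d n} → (Fin n → Line d) → Permutation′ n → Set
IsAutomorphism {d} ℓ σ = Σ (Matrix d d) λ Q →
  IsUnitary Q × (∀ i → image Q (ℓ i) ≐ (_∈ˡ ℓ (σ ⟨$⟩ʳ i)))

DoublyTransitive : ∀ {d n} → (Fin n → Line d) → Set
DoublyTransitive {n = n} ℓ = ∀ (x₁ x₂ y₁ y₂ : Fin n) → x₁ ≢ x₂ → y₁ ≢ y₂ →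
  Σ (Permutation′ n) λ σ →
    IsAutomorphism ℓ σ × σ ⟨$⟩ʳ x₁ ≡ y₁ × σ ⟨$⟩ʳ x₂ ≡ y₂

{-# OPTIONS --safe #-}
module Submission where

-- Let G be the Gram matrix of the φ i and S = Σ φ i (φ i)* their frame operator. An automorphism
-- permutes the entries of G up to unimodular phases: G i j = conj (ω i) ω j G (σ i) (σ j). The
-- phases cancel in G i j * G j i, in (G²) i j * G j i and in (G²) i i, so by double transitivity
-- these are constants β, κ (i ≠ j) and γ. This gives (a), and β G² = κ G + b I with b = β γ − κ.
-- Hence A = β S − κ I satisfies ⟨φ i , A φ j⟩ = b I i j. As the φ i span, S A = b I, and comparing
-- traces n b = d b, so n > d forces b = 0; then A = 0 by spanning again, that is β S = κ I.
-- To avoid deciding whether β = 0, the scalar is taken to be α = S 0 0: from β (S − α I) = 0, and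
-- from G = S = I should β vanish, S = α I follows.

open import Algebra.Bundles using (CommutativeRing)
open import Data.Bool using (if_then_else_)
open import Data.Fin using (Fin; zero; suc; _≟_)
open import Data.Fin.Permutation using (Permutation′; _⟨$⟩ʳ_)
open import Data.Nat as ℕ using (ℕ; zero; suc; _>_)
import Data.Nat.Properties as ℕ
open import Data.Product using (Σ; ∃-syntax; _×_; _,_; proj₁; proj₂)
open import Data.Rational as ℚ using (ℚ; 0ℚ; 1ℚ; ½)
import Data.Rational.Properties as ℚ
import Data.Rational.Solver as ℚSolver
open import Data.Sum using (_⊎_; inj₁; inj₂; [_,_]′)
open import Data.Vec.Functional using (Vector)
open import Function using (_∘_)
open import Level using (_⊔_; 0ℓ) renaming (suc to lsuc)
open import Relation.Binary.PropositionalEquality as ≡ using (_≡_; _≢_)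
open import Relation.Nullary using (Dec; does; yes; no; contradiction)

-- Linear algebra over a commutative ring with involution

-- All algebra below runs over this interface, so that it never meets Cauchy sequences. What else is
-- needed of `ℂ` enters as the explicit hypotheses `TorsionFree` and `ZeroOrCancellable`.
record StarRing c ℓ : Set (lsuc (c ⊔ ℓ)) where
  field
    commutativeRing : CommutativeRing c ℓ
  open CommutativeRing commutativeRing public hiding (zero)
  field
    conj            : Carrier → Carrier
    conj-cong       : ∀ {x y} → x ≈ y → conj x ≈ conj y
    conj-+          : ∀ x y → conj (x + y) ≈ conj x + conj y
    conj-*          : ∀ x y → conj (x * y) ≈ conj x * conj y
    conj-0#         : conj 0# ≈ 0#
    conj-involutive : ∀ x → conj (conj x) ≈ x

module Frames {c ℓ} (R : StarRing c ℓ) where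
  open StarRing R
  import Algebra.Properties.Semiring.Sum semiring as Sum
  open import Algebra.Properties.Monoid.Mult +-monoid using (×-homo-+) renaming (_×_ to _×ⁿ_)
  open import Algebra.Properties.Ring ring using (-‿distribˡ-*; +-cancelˡ; x∙y⁻¹≈ε⇒x≈y)
  open import Algebra.Solver.Ring.NaturalCoefficients.Default commutativeSemiring
    using (solve; _:=_; _:+_; _:*_)
  open import Relation.Binary.Reasoning.Setoid setoid

  infixr 8 _*ᵛ_
  infix  4 _≈ᵐ_

  -- Identity matrices and finite sums

  Matrix : ℕ → ℕ → Set c
  Matrix m n = Fin m → Fin n → Carrier

  _≈ᵐ_ : ∀ {m n} → Matrix m n → Matrix m n → Set ℓ
  A ≈ᵐ B = ∀ k l → A k l ≈ B k l

  I : ∀ {d} → Matrix d d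
  I k l = if does (k ≟ l) then 1# else 0#

  I-diag : ∀ {d} (k : Fin d) → I k k ≈ 1#
  I-diag k with k ≟ k
  ... | yes _   = refl
  ... | no k≢k = contradiction ≡.refl k≢k

  I-off : ∀ {d} {k l : Fin d} → k ≢ l → I k l ≈ 0#
  I-off {k = k} {l} k≢l with k ≟ l
  ... | yes k≡l = contradiction k≡l k≢l
  ... | no _    = refl

  I-sym : ∀ {d} (k l : Fin d) → I k l ≈ I l k
  I-sym k l with k ≟ l
  ... | yes ≡.refl = sym (I-diag k)
  ... | no k≢l     = sym (I-off (k≢l ∘ ≡.sym))

  I-suc : ∀ {d} (k l : Fin d) → I (suc k) (suc l) ≈ I k l
  I-suc k l with k ≟ l
  ... | yes _ = refl
  ... | no _  = refl

  -- Opaque, so that unification treats sum as injective in the summand.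
  opaque
    sum : ∀ {n} → Vector Carrier n → Carrier
    sum = Sum.sum

    sum-cong : ∀ {n} {f g : Vector Carrier n} → (∀ i → f i ≈ g i) → sum f ≈ sum g
    sum-cong = Sum.sum-cong-≋

    sum-distrib-+ : ∀ {n} (f g : Vector Carrier n) → sum (λ i → f i + g i) ≈ sum f + sum g
    sum-distrib-+ = Sum.∑-distrib-+

    *-distribˡ-sum : ∀ {n} x (f : Vector Carrier n) → x * sum f ≈ sum (λ i → x * f i)
    *-distribˡ-sum = Sum.*-distribˡ-sum

    *-distribʳ-sum : ∀ {n} x (f : Vector Carrier n) → sum f * x ≈ sum (λ i → f i * x)
    *-distribʳ-sum = Sum.*-distribʳ-sum

    sum-comm : ∀ {m n} (f : Fin m → Fin n → Carrier) →
               sum (λ i → sum (λ j → f i j)) ≈ sum (λ j → sum (λ i → f i j))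
    sum-comm = Sum.∑-comm

    sum-permute : ∀ {n} (f : Vector Carrier n) (σ : Permutation′ n) → sum f ≈ sum (λ i → f (σ ⟨$⟩ʳ i))
    sum-permute = Sum.sum-permute

    sum-const : ∀ n {x} → sum {n} (λ _ → x) ≈ n ×ⁿ x
    sum-const n = Sum.sum-replicate n

    sum-singleton : (f : Vector Carrier 1) → sum f ≈ f zero
    sum-singleton f = +-identityʳ (f zero)

    sum-I : ∀ {d} (v : Vector Carrier d) k → sum (λ l → I k l * v l) ≈ v k
    sum-I {suc d} v zero = trans
      (+-cong (*-identityˡ _)
        (trans (Sum.sum-cong-≋ λ l → zeroˡ (v (suc l))) (Sum.sum-replicate-zero d)))
      (+-identityʳ _)
    sum-I v (suc k) = begin
      0# * v zero + sum (λ l → I (suc k) (suc l) * v (suc l))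
        ≈⟨ +-cong (zeroˡ _) (sum-cong λ l → *-congʳ (I-suc k l)) ⟩
      0# + sum (λ l → I k l * v (suc l)) ≈⟨ +-identityˡ _ ⟩
      sum (λ l → I k l * v (suc l))      ≈⟨ sum-I (v ∘ suc) k ⟩
      v (suc k)                          ∎

    conj-sum : ∀ {n} (f : Vector Carrier n) → conj (sum f) ≈ sum (conj ∘ f)
    conj-sum {zero}  f = conj-0#
    conj-sum {suc n} f = trans (conj-+ _ _) (+-congˡ (conj-sum (f ∘ suc)))

  -- Matrix action and the sesquilinear form

  _*ᵛ_ : ∀ {m n} → Matrix m n → Vector Carrier n → Vector Carrier m
  (A *ᵛ v) k = sum (λ j → A k j * v j)

  ⟪_,_⟫ : ∀ {d} → Vector Carrier d → Vector Carrier d → Carrier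
  ⟪ u , v ⟫ = sum (λ k → conj (u k) * v k)

  -- The transpose moves across the bilinear pairing: (A x) · y = x · (Aᵀ y). Conjugates are
  -- supplied inside the arguments, so this one identity serves both for adjoints and for
  -- reassociating matrix products.
  sum-swap : ∀ {m n} (A : Matrix m n) (x : Vector Carrier n) (y : Vector Carrier m) →
             sum (λ i → sum (λ j → A i j * x j) * y i) ≈ sum (λ j → x j * sum (λ i → A i j * y i))
  sum-swap A x y = begin
    sum (λ i → sum (λ j → A i j * x j) * y i)
      ≈⟨ sum-cong (λ i → *-distribʳ-sum (y i) _) ⟩
    sum (λ i → sum (λ j → A i j * x j * y i))
      ≈⟨ sum-comm _ ⟩
    sum (λ j → sum (λ i → A i j * x j * y i))
      ≈⟨ sum-cong (λ j → sum-cong λ i →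
           solve 3 (λ a x y → a :* x :* y := x :* (a :* y)) refl (A i j) (x j) (y i)) ⟩
    sum (λ j → sum (λ i → x j * (A i j * y i)))
      ≈⟨ sum-cong (λ j → *-distribˡ-sum (x j) _) ⟨
    sum (λ j → x j * sum (λ i → A i j * y i)) ∎

  ⟪⟫-cong : ∀ {d} {u u′ v v′ : Vector Carrier d} →
            (∀ k → u k ≈ u′ k) → (∀ k → v k ≈ v′ k) → ⟪ u , v ⟫ ≈ ⟪ u′ , v′ ⟫
  ⟪⟫-cong u≈u′ v≈v′ = sum-cong λ k → *-cong (conj-cong (u≈u′ k)) (v≈v′ k)

  conj-⟪⟫ : ∀ {d} (u v : Vector Carrier d) → conj ⟪ u , v ⟫ ≈ ⟪ v , u ⟫
  conj-⟪⟫ u v = begin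
    conj ⟪ u , v ⟫                          ≈⟨ conj-sum _ ⟩
    sum (λ k → conj (conj (u k) * v k))
      ≈⟨ sum-cong (λ k → trans (conj-* _ _) (trans (*-congʳ (conj-involutive _)) (*-comm _ _))) ⟩
    ⟪ v , u ⟫ ∎

  ⟪⟫-scale : ∀ {d} a b (u v : Vector Carrier d) →
             ⟪ (λ k → a * u k) , (λ k → b * v k) ⟫ ≈ conj a * b * ⟪ u , v ⟫
  ⟪⟫-scale a b u v = begin
    sum (λ k → conj (a * u k) * (b * v k))
      ≈⟨ sum-cong (λ k → trans (*-congʳ (conj-* a (u k)))
           (solve 4 (λ a b u v → a :* u :* (b :* v) := a :* b :* (u :* v)) refl
             (conj a) b (conj (u k)) (v k))) ⟩
    sum (λ k → conj a * b * (conj (u k) * v k)) ≈⟨ *-distribˡ-sum _ _ ⟨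
    conj a * b * ⟪ u , v ⟫ ∎

  -- The hypothesis is Q*Q = I, its entries written as inner products of columns; then ⟪Qu, Qv⟫ =
  -- ⟪u, Q*Qv⟫.
  ⟪⟫-isometry : ∀ {d} (Q : Matrix d d) → (λ k l → ⟪ (λ j → Q j k) , (λ j → Q j l) ⟫) ≈ᵐ I →
                ∀ u v → ⟪ Q *ᵛ u , Q *ᵛ v ⟫ ≈ ⟪ u , v ⟫
  ⟪⟫-isometry Q Q†Q≈I u v = begin
    sum (λ k → conj (sum (λ j → Q k j * u j)) * (Q *ᵛ v) k)
      ≈⟨ sum-cong (λ k → *-congʳ (trans (conj-sum _) (sum-cong λ j → conj-* (Q k j) (u j)))) ⟩
    sum (λ k → sum (λ j → conj (Q k j) * conj (u j)) * (Q *ᵛ v) k)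
      ≈⟨ sum-swap _ _ _ ⟩
    sum (λ j → conj (u j) * sum (λ k → conj (Q k j) * (Q *ᵛ v) k))
      ≈⟨ sum-cong (λ j → *-congˡ (Q†Qv j)) ⟩
    ⟪ u , v ⟫ ∎
    where
    Q†Qv : ∀ j → sum (λ k → conj (Q k j) * (Q *ᵛ v) k) ≈ v j
    Q†Qv j = begin
      sum (λ k → conj (Q k j) * sum (λ l → Q k l * v l))
        ≈⟨ sum-cong (λ k → *-comm _ _) ⟩
      sum (λ k → sum (λ l → Q k l * v l) * conj (Q k j))
        ≈⟨ sum-swap Q v _ ⟩
      sum (λ l → v l * sum (λ k → Q k l * conj (Q k j)))
        ≈⟨ sum-cong (λ l → trans (*-comm _ _) (*-congʳ (trans (sum-cong λ k → *-comm _ _) (Q†Q≈I j l)))) ⟩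
      (I *ᵛ v) j ≈⟨ sum-I v j ⟩
      v j ∎

  -- Here u = p₀ b₀ and v = q₀ b₀. Writing v as 1 · v with 1 = ⟪u, u⟫ and exchanging p₀ with q₀ in
  -- the product gives the claim without inverting p₀.
  collinear : ∀ {d} {b : Fin 1 → Vector Carrier d} {u v : Vector Carrier d} {p q : Vector Carrier 1} →
              (∀ k → u k ≈ sum (λ i → p i * b i k)) → (∀ k → v k ≈ sum (λ i → q i * b i k)) →
              ⟪ u , u ⟫ ≈ 1# → ∀ k → v k ≈ ⟪ u , v ⟫ * u k
  collinear {b = b} {u} {v} {p} {q} u∈b v∈b ∥u∥≈1 k = begin
    v k      ≈⟨ *-identityˡ _ ⟨
    1# * v k ≈⟨ *-cong (trans (sym ∥u∥≈1) (trans (⟪⟫-cong u≈pb u≈pb) (⟪⟫-scale p₀ p₀ b₀ b₀))) (v≈qb k) ⟩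
    conj p₀ * p₀ * ⟪ b₀ , b₀ ⟫ * (q₀ * b₀ k)
      ≈⟨ solve 5 (λ p′ p n q x → p′ :* p :* n :* (q :* x) := p′ :* q :* n :* (p :* x)) refl
           (conj p₀) p₀ ⟪ b₀ , b₀ ⟫ q₀ (b₀ k) ⟩
    conj p₀ * q₀ * ⟪ b₀ , b₀ ⟫ * (p₀ * b₀ k)
      ≈⟨ *-cong (trans (⟪⟫-cong u≈pb v≈qb) (⟪⟫-scale p₀ q₀ b₀ b₀)) (u≈pb k) ⟨
    ⟪ u , v ⟫ * u k ∎
    where
    b₀ = b zero
    p₀ = p zero
    q₀ = q zero

    u≈pb : ∀ k → u k ≈ p₀ * b₀ k
    u≈pb k = trans (u∈b k) (sum-singleton _)

    v≈qb : ∀ k → v k ≈ q₀ * b₀ k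
    v≈qb k = trans (v∈b k) (sum-singleton _)

  -- Kernels of linear functionals and spanning families

  module _ {d} (w : Vector Carrier d) where

    annihilates-resp : ∀ {u v : Vector Carrier d} → (∀ k → u k ≈ v k) →
                       sum (λ k → w k * u k) ≈ 0# → sum (λ k → w k * v k) ≈ 0#
    annihilates-resp u≈v wu≈0 = trans (sum-cong λ k → *-congˡ (sym (u≈v k))) wu≈0

    annihilates-0 : sum (λ k → w k * 0#) ≈ 0#
    annihilates-0 = trans (sym (*-distribʳ-sum 0# w)) (zeroʳ _)

    annihilates-+ : ∀ {u v : Vector Carrier d} → sum (λ k → w k * u k) ≈ 0# →
                    sum (λ k → w k * v k) ≈ 0# → sum (λ k → w k * (u k + v k)) ≈ 0#
    annihilates-+ {u} {v} wu≈0 wv≈0 = begin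
      sum (λ k → w k * (u k + v k))                     ≈⟨ sum-cong (λ k → distribˡ _ _ _) ⟩
      sum (λ k → w k * u k + w k * v k)                 ≈⟨ sum-distrib-+ _ _ ⟩
      sum (λ k → w k * u k) + sum (λ k → w k * v k)     ≈⟨ +-cong wu≈0 wv≈0 ⟩
      0# + 0#                                           ≈⟨ +-identityʳ 0# ⟩
      0#                                                ∎

    annihilates-· : ∀ a {u : Vector Carrier d} → sum (λ k → w k * u k) ≈ 0# →
                    sum (λ k → w k * (a * u k)) ≈ 0#
    annihilates-· a {u} wu≈0 = begin
      sum (λ k → w k * (a * u k))
        ≈⟨ sum-cong (λ k → solve 3 (λ w a u → w :* (a :* u) := a :* (w :* u)) refl (w k) a (u k)) ⟩
      sum (λ k → a * (w k * u k)) ≈⟨ *-distribˡ-sum a _ ⟨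
      a * sum (λ k → w k * u k)   ≈⟨ trans (*-congˡ wu≈0) (zeroʳ a) ⟩
      0#                          ∎

    annihilates-basis⇒zero : (∀ l → sum (λ k → w k * I k l) ≈ 0#) → ∀ k → w k ≈ 0#
    annihilates-basis⇒zero wI≈0 l = begin
      w l                       ≈⟨ sum-I w l ⟨
      sum (λ k → I l k * w k)   ≈⟨ sum-cong (λ k → trans (*-comm _ _) (*-congˡ (I-sym l k))) ⟩
      sum (λ k → w k * I k l)   ≈⟨ wI≈0 l ⟩
      0#                        ∎

  -- Spanning in dual form: only the zero functional vanishes on every `φ i`. The pairing carries no
  -- conjugation, so that `w` can be a row of a matrix.
  Spans : ∀ {n d} → (Fin n → Vector Carrier d) → Set (c ⊔ ℓ)
  Spans {d = d} φ = ∀ (w : Vector Carrier d) → (∀ i → sum (λ k → w k * φ i k) ≈ 0#) → ∀ k → w k ≈ 0#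

  -- Characteristic zero, in the form that draws b = 0 from n b = d b with n > d.
  TorsionFree : Set (c ⊔ ℓ)
  TorsionFree = ∀ m x → suc m ×ⁿ x ≈ 0# → x ≈ 0#

  combine : ∀ {m n} → Carrier → Matrix m n → Carrier → Matrix m n → Matrix m n
  combine a A b B k l = a * A k l + b * B k l

  sum-combine : ∀ {n} a b (f g v : Vector Carrier n) →
                sum (λ k → v k * (a * f k + b * g k)) ≈
                a * sum (λ k → v k * f k) + b * sum (λ k → v k * g k)
  sum-combine a b f g v = begin
    sum (λ k → v k * (a * f k + b * g k))
      ≈⟨ sum-cong (λ k → solve 5 (λ a b f g v → v :* (a :* f :+ b :* g) := a :* (v :* f) :+ b :* (v :* g))
           refl a b (f k) (g k) (v k)) ⟩
    sum (λ k → a * (v k * f k) + b * (v k * g k))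
      ≈⟨ sum-distrib-+ _ _ ⟩
    sum (λ k → a * (v k * f k)) + sum (λ k → b * (v k * g k))
      ≈⟨ +-cong (*-distribˡ-sum a _) (*-distribˡ-sum b _) ⟨
    a * sum (λ k → v k * f k) + b * sum (λ k → v k * g k) ∎

  combine-*ᵛ : ∀ {m n} a (A : Matrix m n) b B v k →
               (combine a A b B *ᵛ v) k ≈ a * (A *ᵛ v) k + b * (B *ᵛ v) k
  combine-*ᵛ a A b B v k = begin
    sum (λ l → combine a A b B k l * v l)
      ≈⟨ sum-cong (λ l → *-comm _ _) ⟩
    sum (λ l → v l * combine a A b B k l)
      ≈⟨ sum-combine a b (A k) (B k) v ⟩
    a * sum (λ l → v l * A k l) + b * sum (λ l → v l * B k l)
      ≈⟨ +-cong (*-congˡ (sum-cong λ l → *-comm _ _)) (*-congˡ (sum-cong λ l → *-comm _ _)) ⟩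
    a * (A *ᵛ v) k + b * (B *ᵛ v) k ∎

  ⟪⟫-combine : ∀ {m n} a (A : Matrix m n) b B u v →
               ⟪ u , combine a A b B *ᵛ v ⟫ ≈ a * ⟪ u , A *ᵛ v ⟫ + b * ⟪ u , B *ᵛ v ⟫
  ⟪⟫-combine a A b B u v =
    trans (⟪⟫-cong (λ _ → refl) (combine-*ᵛ a A b B v)) (sum-combine a b (A *ᵛ v) (B *ᵛ v) (conj ∘ u))

  -- The Gram matrix and the frame operator

  module _ {n d} (φ : Fin n → Vector Carrier d) where
    gram : Matrix n n
    gram i j = ⟪ φ i , φ j ⟫

    frame : Matrix d d
    frame k l = sum (λ i → φ i k * conj (φ i l))

    frame-*ᵛ : ∀ v k → (frame *ᵛ v) k ≈ sum (λ i → φ i k * ⟪ φ i , v ⟫)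
    frame-*ᵛ v k = trans
      (sum-cong λ l → *-congʳ (sum-cong λ i → *-comm _ _))
      (sum-swap (λ l i → conj (φ i l)) (λ i → φ i k) v)

    -- At `u = φ i` and `v = φ j` the right side is the entry of G² at i, j; this is how relations
    -- for G² become relations for S.
    ⟪⟫-frame : ∀ u v → ⟪ u , frame *ᵛ v ⟫ ≈ sum (λ i → ⟪ u , φ i ⟫ * ⟪ φ i , v ⟫)
    ⟪⟫-frame u v = begin
      sum (λ k → conj (u k) * (frame *ᵛ v) k)
        ≈⟨ sum-cong (λ k → trans (*-comm _ _) (*-congʳ (frame-*ᵛ v k))) ⟩
      sum (λ k → sum (λ i → φ i k * ⟪ φ i , v ⟫) * conj (u k))
        ≈⟨ sum-swap (λ k i → φ i k) (λ i → ⟪ φ i , v ⟫) (conj ∘ u) ⟩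
      sum (λ i → ⟪ φ i , v ⟫ * sum (λ k → φ i k * conj (u k)))
        ≈⟨ sum-cong (λ i → trans (*-comm _ _) (*-congʳ (sum-cong λ k → *-comm _ _))) ⟩
      sum (λ i → ⟪ u , φ i ⟫ * ⟪ φ i , v ⟫) ∎

    module _ (spans : Spans φ) where
      -- Spanning is used twice: on the conjugate of `A *ᵛ φ j`, since `Spans` is bilinear, to get
      -- `A *ᵛ φ j` = 0, and then on each row of `A`.
      form-zero⇒zero : (A : Matrix d d) → (∀ i j → ⟪ φ i , A *ᵛ φ j ⟫ ≈ 0#) → ∀ k l → A k l ≈ 0#
      form-zero⇒zero A form≈0 k = spans (A k) λ j → begin
        (A *ᵛ φ j) k ≈⟨ conj-involutive _ ⟨
        conj (conj ((A *ᵛ φ j) k))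
          ≈⟨ conj-cong (spans (conj ∘ (A *ᵛ φ j)) (λ i →
               trans (sym (conj-⟪⟫ (φ i) (A *ᵛ φ j))) (trans (conj-cong (form≈0 i j)) conj-0#)) k) ⟩
        conj 0# ≈⟨ conj-0# ⟩
        0# ∎

      -- Writing Φ for the matrix with columns φ i, the hypothesis is Φ* A Φ = b I, so
      -- ΦΦ* A = b I because the φ i span; taking traces of both, n b = d b.
      form-scalar⇒zero : TorsionFree → n > d → (A : Matrix d d) → ∀ {b} →
                         (∀ i j → ⟪ φ i , A *ᵛ φ j ⟫ ≈ b * I i j) → b ≈ 0#
      form-scalar⇒zero torsionFree n>d A {b} form≈b =
        torsionFree m b (+-cancelˡ (d ×ⁿ b) _ _ (begin
          d ×ⁿ b + suc m ×ⁿ b                  ≈⟨ ×-homo-+ b d (suc m) ⟨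
          (d ℕ.+ suc m) ×ⁿ b                   ≡⟨ ≡.cong (_×ⁿ b) d+1+m≡n ⟩
          n ×ⁿ b                               ≈⟨ sum-const n ⟨
          sum {n} (λ i → b)                    ≈⟨ sum-cong (λ i → trans (form≈b i i) (trans (*-congˡ (I-diag i)) (*-identityʳ b))) ⟨
          sum (λ i → ⟪ φ i , A *ᵛ φ i ⟫)       ≈⟨ sum-cong (λ i → ρ-form i i) ⟨
          sum (λ i → sum (λ k → ρ i k * φ i k)) ≈⟨ sum-comm _ ⟩
          sum (λ k → ΦΦ*A k k)                 ≈⟨ sum-cong ΦΦ*A-diag ⟩
          sum {d} (λ k → b)                    ≈⟨ sum-const d ⟩
          d ×ⁿ b                               ≈⟨ +-identityʳ _ ⟨
          d ×ⁿ b + 0#                          ∎))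
        where
        -- Since n > d, n = d + suc m; cancelling d b from n b = d b leaves the multiple of b by suc
        -- m.
        m = n ℕ.∸ suc d

        d+1+m≡n : d ℕ.+ suc m ≡ n
        d+1+m≡n = ≡.trans (ℕ.+-suc d m) (ℕ.m+[n∸m]≡n n>d)

        -- Row i of Φ*A.
        ρ : Fin n → Vector Carrier d
        ρ i l = sum (λ p → A p l * conj (φ i p))

        ρ-form : ∀ i j → sum (λ l → ρ i l * φ j l) ≈ ⟪ φ i , A *ᵛ φ j ⟫
        ρ-form i j = sum-swap (λ l p → A p l) (conj ∘ φ i) (φ j)

        ΦΦ*A : Matrix d d
        ΦΦ*A k l = sum (λ i → ρ i l * φ i k)

        ΦΦ*A-*ᵛ : ∀ j k → (ΦΦ*A *ᵛ φ j) k ≈ b * φ j k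
        ΦΦ*A-*ᵛ j k = begin
          (ΦΦ*A *ᵛ φ j) k
            ≈⟨ sum-swap (λ l i → ρ i l) (λ i → φ i k) (φ j) ⟩
          sum (λ i → φ i k * sum (λ l → ρ i l * φ j l))
            ≈⟨ sum-cong (λ i → *-congˡ (trans (ρ-form i j) (trans (form≈b i j) (*-congˡ (I-sym i j))))) ⟩
          sum (λ i → φ i k * (b * I j i))
            ≈⟨ sum-cong (λ i → solve 3 (λ x b e → x :* (b :* e) := b :* (e :* x)) refl (φ i k) b (I j i)) ⟩
          sum (λ i → b * (I j i * φ i k))
            ≈⟨ *-distribˡ-sum b _ ⟨
          b * (I *ᵛ (λ i → φ i k)) j
            ≈⟨ *-congˡ (sum-I (λ i → φ i k) j) ⟩
          b * φ j k ∎

        -- Each row of ΦΦ*A - b I annihilates every `φ j`, hence vanishes. The trace needs only its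
        -- diagonal entry.
        ΦΦ*A-diag : ∀ k → ΦΦ*A k k ≈ b
        ΦΦ*A-diag k = x∙y⁻¹≈ε⇒x≈y _ _ (begin
          ΦΦ*A k k + - b
            ≈⟨ +-cong (*-identityˡ _) (trans (*-congˡ (I-diag k)) (*-identityʳ _)) ⟨
          combine 1# ΦΦ*A (- b) I k k
            ≈⟨ spans (combine 1# ΦΦ*A (- b) I k) (λ j → begin
                 (combine 1# ΦΦ*A (- b) I *ᵛ φ j) k
                   ≈⟨ combine-*ᵛ 1# ΦΦ*A (- b) I (φ j) k ⟩
                 1# * (ΦΦ*A *ᵛ φ j) k + - b * (I *ᵛ φ j) k
                   ≈⟨ +-cong (trans (*-identityˡ _) (ΦΦ*A-*ᵛ j k)) (*-congˡ (sum-I (φ j) k)) ⟩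
                 b * φ j k + - b * φ j k
                   ≈⟨ +-congˡ (-‿distribˡ-* b (φ j k)) ⟨
                 b * φ j k + - (b * φ j k)
                   ≈⟨ -‿inverseʳ _ ⟩
                 0# ∎) k ⟩
          0# ∎)

  -- Matrices invariant under permutations with phases

  square : ∀ {n} → Matrix n n → Matrix n n
  square M i j = sum (λ k → M i k * M k j)

  -- This is M = U*MU for the monomial matrix U that sends the basis vector e_i to ω i times e_(σ
  -- i).
  Covariant : ∀ {n} → Permutation′ n → Vector Carrier n → Matrix n n → Set ℓ
  Covariant σ ω M = ∀ i j → M i j ≈ conj (ω i) * ω j * M (σ ⟨$⟩ʳ i) (σ ⟨$⟩ʳ j)

  Unimodular : ∀ {n} → Vector Carrier n → Set ℓ
  Unimodular ω = ∀ i → conj (ω i) * ω i ≈ 1#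

  module _ {n} (σ : Permutation′ n) {ω : Vector Carrier n} (unimodular : Unimodular ω) where

    -- The phases at the summation index k meet their conjugates and cancel; σ then merely reindexes
    -- the sum.
    square-covariant : ∀ {M} → Covariant σ ω M → Covariant σ ω (square M)
    square-covariant {M} covariant i j = begin
      sum (λ k → M i k * M k j)
        ≈⟨ sum-cong (λ k → trans (*-cong (covariant i k) (covariant k j))
             (trans
               (solve 6 (λ i′ k k′ j x y → i′ :* k :* x :* (k′ :* j :* y) := k′ :* k :* (i′ :* j :* (x :* y))) refl
                 (conj (ω i)) (ω k) (conj (ω k)) (ω j) _ _)
               (trans (*-congʳ (unimodular k)) (*-identityˡ _)))) ⟩
      sum (λ k → conj (ω i) * ω j * (M (σ ⟨$⟩ʳ i) (σ ⟨$⟩ʳ k) * M (σ ⟨$⟩ʳ k) (σ ⟨$⟩ʳ j)))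
        ≈⟨ *-distribˡ-sum _ _ ⟨
      conj (ω i) * ω j * sum (λ k → M (σ ⟨$⟩ʳ i) (σ ⟨$⟩ʳ k) * M (σ ⟨$⟩ʳ k) (σ ⟨$⟩ʳ j))
        ≈⟨ *-congˡ (sum-permute (λ k → M (σ ⟨$⟩ʳ i) k * M k (σ ⟨$⟩ʳ j)) σ) ⟨
      conj (ω i) * ω j * square M (σ ⟨$⟩ʳ i) (σ ⟨$⟩ʳ j) ∎

    -- The transposed indices of the second factor pair each phase with its conjugate. Two matrices
    -- are allowed so that one of them can be a square.
    product-invariant : ∀ {M N} → Covariant σ ω M → Covariant σ ω N → ∀ i j →
                        M i j * N j i ≈ M (σ ⟨$⟩ʳ i) (σ ⟨$⟩ʳ j) * N (σ ⟨$⟩ʳ j) (σ ⟨$⟩ʳ i)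
    product-invariant {M} {N} covM covN i j = begin
      M i j * N j i ≈⟨ *-cong (covM i j) (covN j i) ⟩
      conj (ω i) * ω j * x * (conj (ω j) * ω i * y)
        ≈⟨ solve 6 (λ i′ j x j′ i y → i′ :* j :* x :* (j′ :* i :* y) := i′ :* i :* (j′ :* j :* (x :* y))) refl
             (conj (ω i)) (ω j) x (conj (ω j)) (ω i) y ⟩
      conj (ω i) * ω i * (conj (ω j) * ω j * (x * y))
        ≈⟨ trans (*-congʳ (unimodular i)) (*-identityˡ _) ⟩
      conj (ω j) * ω j * (x * y)
        ≈⟨ trans (*-congʳ (unimodular j)) (*-identityˡ _) ⟩
      x * y ∎
      where
      x = M (σ ⟨$⟩ʳ i) (σ ⟨$⟩ʳ j)
      y = N (σ ⟨$⟩ʳ j) (σ ⟨$⟩ʳ i)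

    diagonal-invariant : ∀ {M} → Covariant σ ω M → ∀ i → M i i ≈ M (σ ⟨$⟩ʳ i) (σ ⟨$⟩ʳ i)
    diagonal-invariant covM i = trans (covM i i) (trans (*-congʳ (unimodular i)) (*-identityˡ _))

  -- The trace that double transitivity of lines leaves on their Gram matrix.
  TwoHomogeneous : ∀ {n} → Matrix n n → Set (c ⊔ ℓ)
  TwoHomogeneous {n} M = ∀ (x₁ x₂ y₁ y₂ : Fin n) → x₁ ≢ x₂ → y₁ ≢ y₂ →
    Σ (Permutation′ n) λ σ → Σ (Vector Carrier n) λ ω →
      Unimodular ω × Covariant σ ω M × σ ⟨$⟩ʳ x₁ ≡ y₁ × σ ⟨$⟩ʳ x₂ ≡ y₂

  module _ {n} {M : Matrix n n} (homogeneous : TwoHomogeneous M) where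

    product-constant : ∀ {x₁ x₂ y₁ y₂} → x₁ ≢ x₂ → y₁ ≢ y₂ → M x₁ x₂ * M x₂ x₁ ≈ M y₁ y₂ * M y₂ y₁
    product-constant {x₁} {x₂} {y₁} {y₂} x₁≢x₂ y₁≢y₂ with homogeneous x₁ x₂ y₁ y₂ x₁≢x₂ y₁≢y₂
    ... | σ , _ , unimodular , covariant , ≡.refl , ≡.refl =
      product-invariant σ unimodular {M} {M} covariant covariant x₁ x₂

    square-product-constant : ∀ {x₁ x₂ y₁ y₂} → x₁ ≢ x₂ → y₁ ≢ y₂ →
                              square M x₁ x₂ * M x₂ x₁ ≈ square M y₁ y₂ * M y₂ y₁
    square-product-constant {x₁} {x₂} {y₁} {y₂} x₁≢x₂ y₁≢y₂ with homogeneous x₁ x₂ y₁ y₂ x₁≢x₂ y₁≢y₂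
    ... | σ , _ , unimodular , covariant , ≡.refl , ≡.refl =
      product-invariant σ unimodular {square M} {M} (square-covariant σ unimodular {M} covariant) covariant x₁ x₂

    square-diagonal-constant : ∀ x y → square M x x ≈ square M y y
    square-diagonal-constant x y with x ≟ y
    ... | yes ≡.refl = refl
    -- Simple transitivity comes from a symmetry that exchanges x and y.
    ... | no x≢y with homogeneous x y y x x≢y (x≢y ∘ ≡.sym)
    ...   | σ , _ , unimodular , covariant , ≡.refl , _ =
      diagonal-invariant σ unimodular {square M} (square-covariant σ unimodular {M} covariant) x

    entry-zero⇒off-diagonal-zero : ∀ {p q} → p ≢ q → M p q ≈ 0# → ∀ {i j} → i ≢ j → M i j ≈ 0#
    entry-zero⇒off-diagonal-zero {p} {q} p≢q Mpq≈0 {i} {j} i≢j with homogeneous i j p q i≢j p≢q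
    ... | _ , _ , _ , covariant , ≡.refl , ≡.refl =
      trans (covariant i j) (trans (*-congˡ Mpq≈0) (zeroʳ _))

    -- Off the diagonal, β is rewritten as `M i j * M j i`; regrouping makes the constant κ =
    -- `square M i j * M j i` appear in front of `M i j`. The coefficient of `I` is what remains on
    -- the diagonal.
    quadratic : (∀ i → M i i ≈ 1#) → ∀ {p q} → p ≢ q →
                let β = M p q * M q p
                    κ = square M p q * M q p
                in ∀ i j → β * square M i j ≈ κ * M i j + (β * square M p p + - κ) * I i j
    quadratic Mii≈1 {p} {q} p≢q i j with i ≟ j
    ... | yes ≡.refl = begin
      β * square M i i                       ≈⟨ *-congˡ (square-diagonal-constant i p) ⟩
      βγ                                     ≈⟨ +-identityʳ _ ⟨
      βγ + 0#                                ≈⟨ +-congˡ (-‿inverseʳ κ) ⟨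
      βγ + (κ + - κ)                         ≈⟨ solve 3 (λ x y z → x :+ (y :+ z) := y :+ (x :+ z)) refl βγ κ (- κ) ⟩
      κ + (βγ + - κ)                         ≈⟨ +-cong (trans (*-congˡ (Mii≈1 i)) (*-identityʳ _)) (*-identityʳ _) ⟨
      κ * M i i + (βγ + - κ) * 1#            ∎
      where
      β = M p q * M q p
      κ = square M p q * M q p
      βγ = β * square M p p
    ... | no i≢j = begin
      β * square M i j                  ≈⟨ *-congʳ (product-constant p≢q i≢j) ⟩
      M i j * M j i * square M i j      ≈⟨ solve 3 (λ x y z → x :* y :* z := z :* y :* x) refl _ _ _ ⟩
      square M i j * M j i * M i j      ≈⟨ *-congʳ (square-product-constant i≢j p≢q) ⟩
      κ * M i j                         ≈⟨ +-identityʳ _ ⟨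
      κ * M i j + 0#                    ≈⟨ +-congˡ (zeroʳ _) ⟨
      κ * M i j + (β * square M p p + - κ) * 0# ∎
      where
      β = M p q * M q p
      κ = square M p q * M q p

  -- Isometries acting on Gram matrices

  module _ {n d} {φ : Fin n → Vector Carrier d} (unit : ∀ i → ⟪ φ i , φ i ⟫ ≈ 1#)
           (σ : Permutation′ n) {Q : Matrix d d} {ω : Vector Carrier n}
           (isometry : ∀ u v → ⟪ Q *ᵛ u , Q *ᵛ v ⟫ ≈ ⟪ u , v ⟫)
           (Qφ≈ωφ : ∀ i k → (Q *ᵛ φ i) k ≈ ω i * φ (σ ⟨$⟩ʳ i) k) where

    gram-covariant : Covariant σ ω (gram φ)
    gram-covariant i j = begin
      ⟪ φ i , φ j ⟫           ≈⟨ isometry (φ i) (φ j) ⟨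
      ⟪ Q *ᵛ φ i , Q *ᵛ φ j ⟫ ≈⟨ ⟪⟫-cong (Qφ≈ωφ i) (Qφ≈ωφ j) ⟩
      ⟪ (λ k → ω i * φ (σ ⟨$⟩ʳ i) k) , (λ k → ω j * φ (σ ⟨$⟩ʳ j) k) ⟫
                              ≈⟨ ⟪⟫-scale (ω i) (ω j) _ _ ⟩
      conj (ω i) * ω j * ⟪ φ (σ ⟨$⟩ʳ i) , φ (σ ⟨$⟩ʳ j) ⟫ ∎

    -- Covariance on the diagonal compares two unit norms, so the factor between them is 1.
    phase-unimodular : Unimodular ω
    phase-unimodular i = begin
      conj (ω i) * ω i      ≈⟨ *-identityʳ _ ⟨
      conj (ω i) * ω i * 1# ≈⟨ *-congˡ (unit (σ ⟨$⟩ʳ i)) ⟨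
      conj (ω i) * ω i * ⟪ φ (σ ⟨$⟩ʳ i) , φ (σ ⟨$⟩ʳ i) ⟫ ≈⟨ gram-covariant i i ⟨
      ⟪ φ i , φ i ⟫         ≈⟨ unit i ⟩
      1#                    ∎

  gram-modulus-constant : ∀ {n d} (φ : Fin n → Vector Carrier d) → TwoHomogeneous (gram φ) →
    ∀ {x₁ x₂ y₁ y₂} → x₁ ≢ x₂ → y₁ ≢ y₂ →
    conj ⟪ φ x₁ , φ x₂ ⟫ * ⟪ φ x₁ , φ x₂ ⟫ ≈ conj ⟪ φ y₁ , φ y₂ ⟫ * ⟪ φ y₁ , φ y₂ ⟫
  gram-modulus-constant φ homogeneous {x₁} {x₂} {y₁} {y₂} x₁≢x₂ y₁≢y₂ = begin
    conj ⟪ φ x₁ , φ x₂ ⟫ * ⟪ φ x₁ , φ x₂ ⟫ ≈⟨ *-congʳ (conj-⟪⟫ _ _) ⟩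
    ⟪ φ x₂ , φ x₁ ⟫ * ⟪ φ x₁ , φ x₂ ⟫
      ≈⟨ product-constant homogeneous (x₁≢x₂ ∘ ≡.sym) (y₁≢y₂ ∘ ≡.sym) ⟩
    ⟪ φ y₂ , φ y₁ ⟫ * ⟪ φ y₁ , φ y₂ ⟫      ≈⟨ *-congʳ (conj-⟪⟫ _ _) ⟨
    conj ⟪ φ y₁ , φ y₂ ⟫ * ⟪ φ y₁ , φ y₂ ⟫ ∎

  -- A constructive substitute for deciding whether z is zero: it is what "z = 0 or z is
  -- cancellable" implies for stable equations.
  ZeroOrCancellable : Set (c ⊔ ℓ)
  ZeroOrCancellable = ∀ z x → conj z * z * x ≈ 0# → (z ≈ 0# → x ≈ 0#) → x ≈ 0#

  -- Tightness of the frame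

  module _ (torsionFree : TorsionFree) (zeroOrCancellable : ZeroOrCancellable)
           {n d} {φ : Fin n → Vector Carrier d} (spans : Spans φ)
           (unit : ∀ i → ⟪ φ i , φ i ⟫ ≈ 1#) (homogeneous : TwoHomogeneous (gram φ)) where

    private
      G = gram φ
      S = frame φ

    -- With φ as the columns of Φ: Φ*SΦ = G² and Φ*IΦ = G.
    form-combine : ∀ β κ i j →
                   ⟪ φ i , combine β S κ I *ᵛ φ j ⟫ ≈ β * square G i j + κ * G i j
    form-combine β κ i j = trans (⟪⟫-combine β S κ I (φ i) (φ j))
      (+-cong (*-congˡ (⟪⟫-frame φ (φ i) (φ j))) (*-congˡ (⟪⟫-cong (λ _ → refl) (sum-I (φ j)))))

    combine-zero⇒scalar : ∀ {β κ} → (∀ i j → β * square G i j + κ * G i j ≈ 0#) →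
                          ∀ k l → β * S k l + κ * I k l ≈ 0#
    combine-zero⇒scalar {β} {κ} eq = form-zero⇒zero φ spans (combine β S κ I) λ i j →
      trans (form-combine β κ i j) (eq i j)

    -- The hypothesis at the diagonal entry k₀ says κ = -β `S k₀ k₀`, which eliminates κ from the
    -- other entries.
    scalar-multiple : ∀ {β κ} → (∀ k l → β * S k l + κ * I k l ≈ 0#) →
                      ∀ k₀ k l → β * (S k l + - (S k₀ k₀ * I k l)) ≈ 0#
    scalar-multiple {β} {κ} eq k₀ k l = begin
      β * (S k l + t)
        ≈⟨ trans (+-congˡ (zeroˡ _)) (+-identityʳ _) ⟨
      β * (S k l + t) + 0# * e
        ≈⟨ +-congˡ (*-congʳ (trans (+-congˡ (trans (sym (*-identityʳ κ)) (*-congˡ (sym (I-diag k₀))))) (eq k₀ k₀))) ⟨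
      β * (S k l + t) + (β * s + κ) * e
        ≈⟨ solve 6 (λ β x t s κ e → β :* (x :+ t) :+ (β :* s :+ κ) :* e :=
                                    (β :* x :+ κ :* e) :+ β :* (s :* e :+ t)) refl
             β (S k l) t s κ e ⟩
      (β * S k l + κ * e) + β * (s * e + t)
        ≈⟨ +-cong (eq k l) (trans (*-congˡ (-‿inverseʳ _)) (zeroʳ β)) ⟩
      0# + 0# ≈⟨ +-identityʳ 0# ⟩
      0# ∎
      where
      s = S k₀ k₀
      e = I k l
      t = - (s * e)

    gram≈I : ∀ {p q} → p ≢ q → G p q ≈ 0# → ∀ i j → G i j ≈ I i j
    gram≈I p≢q Gpq≈0 i j with i ≟ j
    ... | yes ≡.refl = unit i
    ... | no i≢j     = entry-zero⇒off-diagonal-zero homogeneous p≢q Gpq≈0 i≢j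

    frame-scalar : n > d → ∀ {p q} → p ≢ q → ∀ k₀ k l → S k l ≈ S k₀ k₀ * I k l
    frame-scalar n>d {p} {q} p≢q k₀ k l = x∙y⁻¹≈ε⇒x≈y _ _
      -- Cancels β = |G p q|² from β times an entry of S - `S k₀ k₀` I.
      (zeroOrCancellable (G p q) _
        (trans (*-congʳ (trans (*-congʳ (conj-⟪⟫ (φ p) (φ q))) (*-comm _ _)))
               (scalar-multiple (combine-zero⇒scalar β*G²-κ*G≈0) k₀ k l))
        -- If `G p q` is 0, then G = I, and the relation G² - G = 0 has leading coefficient 1, so no
        -- factor is left to cancel.
        (λ Gpq≈0 → trans (sym (*-identityˡ _))
                     (scalar-multiple (combine-zero⇒scalar (G²-G≈0 Gpq≈0)) k₀ k l)))
      where
      β = G p q * G q p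
      κ = square G p q * G q p
      b = β * square G p p + - κ

      β*G²-κ*G≈b*I : ∀ i j → β * square G i j + - κ * G i j ≈ b * I i j
      β*G²-κ*G≈b*I i j = begin
        β * square G i j + - κ * G i j
          ≈⟨ +-congʳ (quadratic homogeneous unit p≢q i j) ⟩
        κ * G i j + b * I i j + - κ * G i j
          ≈⟨ solve 4 (λ κ κ′ g e → κ :* g :+ e :+ κ′ :* g := e :+ (κ :+ κ′) :* g) refl κ (- κ) (G i j) (b * I i j) ⟩
        b * I i j + (κ + - κ) * G i j
          ≈⟨ +-congˡ (trans (*-congʳ (-‿inverseʳ κ)) (zeroˡ _)) ⟩
        b * I i j + 0#
          ≈⟨ +-identityʳ _ ⟩
        b * I i j ∎

      -- Here n > d enters: the form of βS - κI on the φ is b I.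
      b≈0 : b ≈ 0#
      b≈0 = form-scalar⇒zero φ spans torsionFree n>d (combine β S (- κ) I) λ i j →
        trans (form-combine β (- κ) i j) (β*G²-κ*G≈b*I i j)

      β*G²-κ*G≈0 : ∀ i j → β * square G i j + - κ * G i j ≈ 0#
      β*G²-κ*G≈0 i j = trans (β*G²-κ*G≈b*I i j) (trans (*-congʳ b≈0) (zeroˡ _))

      G²-G≈0 : G p q ≈ 0# → ∀ i j → 1# * square G i j + - 1# * G i j ≈ 0#
      G²-G≈0 Gpq≈0 i j = begin
        1# * square G i j + - 1# * G i j
          ≈⟨ +-congʳ (*-congˡ (trans (sum-cong λ k → *-congʳ (gram≈I p≢q Gpq≈0 i k)) (sum-I (λ k → G k j) i))) ⟩
        1# * G i j + - 1# * G i j   ≈⟨ distribʳ (G i j) 1# (- 1#) ⟨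
        (1# + - 1#) * G i j         ≈⟨ trans (*-congʳ (-‿inverseʳ 1#)) (zeroˡ _) ⟩
        0# ∎

-- Null sequences of rationals

open import Defs
open CauchyLemmas using (half-pos; half+half; 0<1; bounded; *-mono-∣∣; divide)
open ℚSolver.+-*-Solver using (solve; con; _:=_; _:+_; _:*_; _:-_; :-_)

eventually-× : ∀ {P Q : ℕ → Set} → Eventually P → Eventually Q → Eventually (λ n → P n × Q n)
eventually-× (M , p) (N , q) = M ℕ.⊔ N , λ n n≥ → p n (ℕ.m⊔n≤o⇒m≤o M N n≥) , q n (ℕ.m⊔n≤o⇒n≤o M N n≥)

eventually-map : ∀ {P Q : ℕ → Set} → (∀ n → P n → Q n) → Eventually P → Eventually Q
eventually-map f (N , p) = N , λ n n≥ → f n (p n n≥)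

-- By definition `x ≃ y` is `Null` of the difference, so laws of real equality become closure
-- properties of null sequences.
Null : (ℕ → ℚ) → Set
Null f = ∀ ε → 0ℚ ℚ.< ε → Eventually (λ n → ℚ.∣ f n ∣ ℚ.< ε)

module _ where
  open ℚ.≤-Reasoning

  null-cong : ∀ {f g : ℕ → ℚ} → (∀ n → f n ≡ g n) → Null f → Null g
  null-cong f≗g null ε 0<ε = eventually-map (λ n → ≡.subst (λ q → ℚ.∣ q ∣ ℚ.< ε) (f≗g n)) (null ε 0<ε)

  null-0 : Null (λ _ → 0ℚ)
  null-0 ε 0<ε = 0 , λ _ _ → 0<ε

  null-+ : ∀ {f g : ℕ → ℚ} → Null f → Null g → Null (λ n → f n ℚ.+ g n)
  null-+ {f} {g} nullf nullg ε 0<ε =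
    eventually-map (λ n (f<ε/2 , g<ε/2) → begin-strict
      ℚ.∣ f n ℚ.+ g n ∣             ≤⟨ ℚ.∣p+q∣≤∣p∣+∣q∣ (f n) (g n) ⟩
      ℚ.∣ f n ∣ ℚ.+ ℚ.∣ g n ∣       <⟨ ℚ.+-mono-< f<ε/2 g<ε/2 ⟩
      ½ ℚ.* ε ℚ.+ ½ ℚ.* ε           ≡⟨ half+half ε ⟩
      ε                             ∎)
      (eventually-× (nullf _ (half-pos 0<ε)) (nullg _ (half-pos 0<ε)))

  null-neg : ∀ {f} → Null f → Null (λ n → ℚ.- f n)
  null-neg {f} null ε 0<ε =
    eventually-map (λ n → ≡.subst (ℚ._< ε) (≡.sym (ℚ.∣-p∣≡∣p∣ (f n)))) (null ε 0<ε)

  null-* : ∀ x {f} → Null f → Null (λ n → seq x n ℚ.* f n)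
  null-* x {f} null ε 0<ε =
    let B , 0≤B , x≤B = bounded x
        -- The bound B may be 0; the divisor 1 + B is positive and makes B δ < ε strict.
        δ , 0<δ , 1+B*δ≡ε = divide (1ℚ ℚ.+ B) ε (ℚ.+-mono-<-≤ 0<1 0≤B) 0<ε
    in eventually-map (λ n (xn≤B , fn<δ) → begin-strict
      ℚ.∣ seq x n ℚ.* f n ∣ ≤⟨ *-mono-∣∣ {seq x n} {f n} xn≤B 0≤B (ℚ.<⇒≤ fn<δ) ⟩
      B ℚ.* δ               ≡⟨ ℚ.+-identityˡ _ ⟨
      0ℚ ℚ.+ B ℚ.* δ        <⟨ ℚ.+-monoˡ-< (B ℚ.* δ) 0<δ ⟩
      δ ℚ.+ B ℚ.* δ         ≡⟨ ≡.cong (ℚ._+ B ℚ.* δ) (ℚ.*-identityˡ δ) ⟨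
      1ℚ ℚ.* δ ℚ.+ B ℚ.* δ  ≡⟨ ℚ.*-distribʳ-+ δ 1ℚ B ⟨
      (1ℚ ℚ.+ B) ℚ.* δ      ≡⟨ 1+B*δ≡ε ⟩
      ε                     ∎) (eventually-× x≤B (null δ 0<δ))

  -- For a Cauchy sequence, this is apartness of its limit from 0.
  BoundedAway : (ℕ → ℚ) → Set
  BoundedAway f = ∃[ δ ] (0ℚ ℚ.< δ × Eventually (λ n → δ ℚ.≤ ℚ.∣ f n ∣))

  null-cancel : ∀ {f g : ℕ → ℚ} → BoundedAway g → Null (λ n → f n ℚ.* g n) → Null f
  null-cancel {f} {g} (δ , 0<δ , δ≤g) null ε 0<ε =
    eventually-map (λ n (δ≤gn , fgn<εδ) → ℚ.*-cancelʳ-<-nonNeg δ {{ℚ.nonNegative (ℚ.<⇒≤ 0<δ)}} (begin-strict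
      ℚ.∣ f n ∣ ℚ.* δ         ≤⟨ ℚ.*-monoˡ-≤-nonNeg ℚ.∣ f n ∣ {{ℚ.∣-∣-nonNeg (f n)}} δ≤gn ⟩
      ℚ.∣ f n ∣ ℚ.* ℚ.∣ g n ∣ ≡⟨ ℚ.∣p*q∣≡∣p∣*∣q∣ (f n) (g n) ⟨
      ℚ.∣ f n ℚ.* g n ∣       <⟨ fgn<εδ ⟩
      ε ℚ.* δ                 ∎))
      (eventually-× δ≤g (null (ε ℚ.* δ) 0<εδ))
    where
    0<εδ : 0ℚ ℚ.< ε ℚ.* δ
    0<εδ = ≡.subst (ℚ._< ε ℚ.* δ) (ℚ.*-zeroˡ δ) (ℚ.*-monoˡ-<-pos δ {{ℚ.positive 0<δ}} 0<ε)

  -- One rational comparison decides: with δ = ε/4, choose N past which the terms differ by less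
  -- than δ. If |x_N| < 2δ, the tail stays below 3δ < ε; otherwise it stays at least δ.
  small-or-away : ∀ x ε → 0ℚ ℚ.< ε → Eventually (λ n → ℚ.∣ seq x n ∣ ℚ.< ε) ⊎ BoundedAway (seq x)
  small-or-away x ε 0<ε = let N , close = cauchy x δ 0<δ in compare N close (ℚ.∣ seq x N ∣ ℚ.<? δ ℚ.+ δ)
    where
    δ = ½ ℚ.* (½ ℚ.* ε)

    0<δ : 0ℚ ℚ.< δ
    0<δ = half-pos (half-pos 0<ε)

    δ+[δ+δ]<ε : δ ℚ.+ (δ ℚ.+ δ) ℚ.< ε
    δ+[δ+δ]<ε = begin-strict
      δ ℚ.+ (δ ℚ.+ δ)          ≡⟨ ℚ.+-identityˡ _ ⟨
      0ℚ ℚ.+ (δ ℚ.+ (δ ℚ.+ δ)) <⟨ ℚ.+-monoˡ-< (δ ℚ.+ (δ ℚ.+ δ)) 0<δ ⟩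
      δ ℚ.+ (δ ℚ.+ (δ ℚ.+ δ))  ≡⟨ ℚ.+-assoc δ δ (δ ℚ.+ δ) ⟨
      (δ ℚ.+ δ) ℚ.+ (δ ℚ.+ δ)  ≡⟨ ≡.cong₂ ℚ._+_ (half+half (½ ℚ.* ε)) (half+half (½ ℚ.* ε)) ⟩
      ½ ℚ.* ε ℚ.+ ½ ℚ.* ε      ≡⟨ half+half ε ⟩
      ε                        ∎

    compare : ∀ N → (∀ m n → N ℕ.≤ m → N ℕ.≤ n → ℚ.∣ seq x m ℚ.- seq x n ∣ ℚ.< δ) →
              Dec (ℚ.∣ seq x N ∣ ℚ.< δ ℚ.+ δ) →
              Eventually (λ n → ℚ.∣ seq x n ∣ ℚ.< ε) ⊎ BoundedAway (seq x)
    compare N close (yes small) = inj₁ (N , λ n n≥ → begin-strict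
      ℚ.∣ seq x n ∣
        ≡⟨ ≡.cong ℚ.∣_∣ (solve 2 (λ a b → a := (a :- b) :+ b) ≡.refl (seq x n) (seq x N)) ⟩
      ℚ.∣ (seq x n ℚ.- seq x N) ℚ.+ seq x N ∣     ≤⟨ ℚ.∣p+q∣≤∣p∣+∣q∣ (seq x n ℚ.- seq x N) (seq x N) ⟩
      ℚ.∣ seq x n ℚ.- seq x N ∣ ℚ.+ ℚ.∣ seq x N ∣ <⟨ ℚ.+-mono-< (close n N n≥ ℕ.≤-refl) small ⟩
      δ ℚ.+ (δ ℚ.+ δ)                             <⟨ δ+[δ+δ]<ε ⟩
      ε                                           ∎)
    compare N close (no ¬small) = inj₂ (δ , 0<δ , N , λ n n≥ → begin
      δ                           ≡⟨ solve 1 (λ δ → δ := (δ :+ δ) :- δ) ≡.refl δ ⟩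
      (δ ℚ.+ δ) ℚ.- δ             ≤⟨ ℚ.+-monoˡ-≤ (ℚ.- δ) (begin
        δ ℚ.+ δ                                     ≤⟨ ℚ.≮⇒≥ ¬small ⟩
        ℚ.∣ seq x N ∣
          ≡⟨ ≡.cong ℚ.∣_∣ (solve 2 (λ a b → b := a :+ (b :- a)) ≡.refl (seq x n) (seq x N)) ⟩
        ℚ.∣ seq x n ℚ.+ (seq x N ℚ.- seq x n) ∣     ≤⟨ ℚ.∣p+q∣≤∣p∣+∣q∣ (seq x n) (seq x N ℚ.- seq x n) ⟩
        ℚ.∣ seq x n ∣ ℚ.+ ℚ.∣ seq x N ℚ.- seq x n ∣ ≤⟨ ℚ.+-monoʳ-≤ ℚ.∣ seq x n ∣ (ℚ.<⇒≤ (close N n ℕ.≤-refl n≥)) ⟩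
        ℚ.∣ seq x n ∣ ℚ.+ δ                         ∎) ⟩
      (ℚ.∣ seq x n ∣ ℚ.+ δ) ℚ.- δ ≡⟨ solve 2 (λ a δ → (a :+ δ) :- δ := a) ≡.refl ℚ.∣ seq x n ∣ δ ⟩
      ℚ.∣ seq x n ∣               ∎)

  -- The goal fixes an ε first, so `small-or-away` applies to x: either its tail is below ε already,
  -- or x cancels from the product, f is null, and the second hypothesis applies.
  null-or-cancellable : ∀ x {f} → Null (λ n → f n ℚ.* seq x n) → (Null f → Null (seq x)) → Null (seq x)
  null-or-cancellable x {f} nullfx null⇒null ε 0<ε =
    [ (λ small → small) , (λ away → null⇒null (null-cancel {f} away nullfx) ε 0<ε) ]′ (small-or-away x ε 0<ε)

  p*p≡∣p∣*∣p∣ : ∀ p → p ℚ.* p ≡ ℚ.∣ p ∣ ℚ.* ℚ.∣ p ∣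
  p*p≡∣p∣*∣p∣ p with ℚ.∣p∣≡p∨∣p∣≡-p p
  ... | inj₁ eq rewrite eq = ≡.refl
  ... | inj₂ eq rewrite eq = solve 1 (λ p → p :* p := (:- p) :* (:- p)) ≡.refl p

  0≤p*p : ∀ p → 0ℚ ℚ.≤ p ℚ.* p
  0≤p*p p = begin
    0ℚ                       ≤⟨ ℚ.0≤∣p∣ (p ℚ.* p) ⟩
    ℚ.∣ p ℚ.* p ∣            ≡⟨ ℚ.∣p*q∣≡∣p∣*∣q∣ p p ⟩
    ℚ.∣ p ∣ ℚ.* ℚ.∣ p ∣      ≡⟨ p*p≡∣p∣*∣p∣ p ⟨
    p ℚ.* p                  ∎

  -- Square roots are avoided: once the sum is below ε², having ε ≤ |f n| would be contradictory.
  null-sum-of-squares : ∀ {f g : ℕ → ℚ} → Null (λ n → f n ℚ.* f n ℚ.+ g n ℚ.* g n) → Null f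
  null-sum-of-squares {f} {g} null ε 0<ε = eventually-map (λ n sq<ε² → ℚ.≰⇒> λ ε≤f →
    ℚ.<-irrefl ≡.refl (begin-strict
      ε ℚ.* ε                               ≤⟨ ℚ.*-monoˡ-≤-nonNeg ε {{ε≥0}} ε≤f ⟩
      ε ℚ.* ℚ.∣ f n ∣                       ≤⟨ ℚ.*-monoʳ-≤-nonNeg ℚ.∣ f n ∣ {{ℚ.∣-∣-nonNeg (f n)}} ε≤f ⟩
      ℚ.∣ f n ∣ ℚ.* ℚ.∣ f n ∣               ≡⟨ p*p≡∣p∣*∣p∣ (f n) ⟨
      f n ℚ.* f n                           ≡⟨ ℚ.+-identityʳ (f n ℚ.* f n) ⟨
      f n ℚ.* f n ℚ.+ 0ℚ                    ≤⟨ ℚ.+-monoʳ-≤ (f n ℚ.* f n) (0≤p*p (g n)) ⟩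
      f n ℚ.* f n ℚ.+ g n ℚ.* g n
        ≡⟨ ℚ.0≤p⇒∣p∣≡p (ℚ.+-mono-≤ (0≤p*p (f n)) (0≤p*p (g n))) ⟨
      ℚ.∣ f n ℚ.* f n ℚ.+ g n ℚ.* g n ∣     <⟨ sq<ε² ⟩
      ε ℚ.* ε                               ∎))
    (null (ε ℚ.* ε) 0<ε²)
    where
    ε≥0 : ℚ.NonNegative ε
    ε≥0 = ℚ.nonNegative (ℚ.<⇒≤ 0<ε)
    0<ε² : 0ℚ ℚ.< ε ℚ.* ε
    0<ε² = ≡.subst (ℚ._< ε ℚ.* ε) (ℚ.*-zeroˡ ε) (ℚ.*-monoˡ-<-pos ε {{ℚ.positive 0<ε}} 0<ε)

-- ℂ as a commutative ring with involution

-- The operations act termwise, so ring laws reduce to rational identities at each index.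
≃-pointwise : ∀ x y → (∀ n → seq x n ≡ seq y n) → x ≃ y
≃-pointwise x y x≗y = null-cong
  (λ n → ≡.trans (≡.sym (ℚ.+-inverseʳ (seq y n))) (≡.cong (ℚ._- seq y n) (≡.sym (x≗y n)))) null-0

≃-sym : ∀ {x y} → x ≃ y → y ≃ x
≃-sym {x} {y} x≃y = null-cong
  (λ n → solve 2 (λ a b → :- (a :- b) := b :- a) ≡.refl (seq x n) (seq y n))
  (null-neg {λ n → seq x n ℚ.- seq y n} x≃y)

≃-trans : ∀ {x y z} → x ≃ y → y ≃ z → x ≃ z
≃-trans {x} {y} {z} x≃y y≃z = null-cong
  (λ n → solve 3 (λ a b c → (a :- b) :+ (b :- c) := a :- c) ≡.refl (seq x n) (seq y n) (seq z n))
  (null-+ {λ n → seq x n ℚ.- seq y n} {λ n → seq y n ℚ.- seq z n} x≃y y≃z)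

+ᴿ-cong : ∀ {x y u v} → x ≃ y → u ≃ v → x +ᴿ u ≃ y +ᴿ v
+ᴿ-cong {x} {y} {u} {v} x≃y u≃v = null-cong
  (λ n → solve 4 (λ a b c d → (a :- b) :+ (c :- d) := (a :+ c) :- (b :+ d)) ≡.refl
    (seq x n) (seq y n) (seq u n) (seq v n))
  (null-+ {λ n → seq x n ℚ.- seq y n} {λ n → seq u n ℚ.- seq v n} x≃y u≃v)

negᴿ-cong : ∀ {x y} → x ≃ y → negᴿ x ≃ negᴿ y
negᴿ-cong {x} {y} x≃y = null-cong
  (λ n → solve 2 (λ a b → :- (a :- b) := :- a :- :- b) ≡.refl (seq x n) (seq y n))
  (null-neg {λ n → seq x n ℚ.- seq y n} x≃y)

-- Uses x u - y v = u (x - y) + y (u - v): a Cauchy sequence is bounded, so its product with a null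
-- one is null.
*ᴿ-cong : ∀ {x y u v} → x ≃ y → u ≃ v → x *ᴿ u ≃ y *ᴿ v
*ᴿ-cong {x} {y} {u} {v} x≃y u≃v = null-cong
  (λ n → solve 4 (λ a b c d → c :* (a :- b) :+ b :* (c :- d) := a :* c :- b :* d) ≡.refl
    (seq x n) (seq y n) (seq u n) (seq v n))
  (null-+ {λ n → seq u n ℚ.* (seq x n ℚ.- seq y n)} {λ n → seq y n ℚ.* (seq u n ℚ.- seq v n)}
    (null-* u {λ n → seq x n ℚ.- seq y n} x≃y) (null-* y {λ n → seq u n ℚ.- seq v n} u≃v))

≃0⇒null : ∀ {x} → x ≃ 0ℝ → Null (seq x)
≃0⇒null {x} = null-cong (λ n → ℚ.+-identityʳ (seq x n))

null⇒≃0 : ∀ {x} → Null (seq x) → x ≃ 0ℝ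
null⇒≃0 {x} = null-cong (λ n → ≡.sym (ℚ.+-identityʳ (seq x n)))

*ᴿ-zero-or-cancellable : ∀ x y → x *ᴿ y ≃ 0ℝ → (x ≃ 0ℝ → y ≃ 0ℝ) → y ≃ 0ℝ
*ᴿ-zero-or-cancellable x y xy≃0 x≃0⇒y≃0 = null⇒≃0 {y}
  (null-or-cancellable y {seq x} (≃0⇒null {x *ᴿ y} xy≃0)
    (λ nullx → ≃0⇒null {y} (x≃0⇒y≃0 (null⇒≃0 {x} nullx))))

≈-pointwise : ∀ z w → (∀ n → seq (re z) n ≡ seq (re w) n) → (∀ n → seq (im z) n ≡ seq (im w) n) → z ≈ w
≈-pointwise z w re≗ im≗ = ≃-pointwise (re z) (re w) re≗ , ≃-pointwise (im z) (im w) im≗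

≈-refl : ∀ {z} → z ≈ z
≈-refl {z} = ≈-pointwise z z (λ _ → ≡.refl) (λ _ → ≡.refl)

≈-sym : ∀ {z w} → z ≈ w → w ≈ z
≈-sym {z} {w} (re≃ , im≃) = ≃-sym {re z} {re w} re≃ , ≃-sym {im z} {im w} im≃

≈-trans : ∀ {u z w} → u ≈ z → z ≈ w → u ≈ w
≈-trans {u} {z} {w} (re≃ , im≃) (re≃′ , im≃′) =
  ≃-trans {re u} {re z} {re w} re≃ re≃′ , ≃-trans {im u} {im z} {im w} im≃ im≃′

+-cong : ∀ {z z′ w w′} → z ≈ z′ → w ≈ w′ → z + w ≈ z′ + w′
+-cong {z} {z′} {w} {w′} (re≃ , im≃) (re≃′ , im≃′) =
  +ᴿ-cong {re z} {re z′} {re w} {re w′} re≃ re≃′ , +ᴿ-cong {im z} {im z′} {im w} {im w′} im≃ im≃′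

-‿cong : ∀ {z w} → z ≈ w → - z ≈ - w
-‿cong {z} {w} (re≃ , im≃) = negᴿ-cong {re z} {re w} re≃ , negᴿ-cong {im z} {im w} im≃

*-cong : ∀ {z z′ w w′} → z ≈ z′ → w ≈ w′ → z * w ≈ z′ * w′
*-cong {a +i b} {a′ +i b′} {c +i d} {c′ +i d′} (a≃ , b≃) (c≃ , d≃) =
  +ᴿ-cong {a *ᴿ c} {a′ *ᴿ c′} {negᴿ (b *ᴿ d)} {negᴿ (b′ *ᴿ d′)}
    (*ᴿ-cong {a} {a′} {c} {c′} a≃ c≃)
    (negᴿ-cong {b *ᴿ d} {b′ *ᴿ d′} (*ᴿ-cong {b} {b′} {d} {d′} b≃ d≃)) ,
  +ᴿ-cong {a *ᴿ d} {a′ *ᴿ d′} {b *ᴿ c} {b′ *ᴿ c′}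
    (*ᴿ-cong {a} {a′} {d} {d′} a≃ d≃) (*ᴿ-cong {b} {b′} {c} {c′} b≃ c≃)

conj-cong : ∀ {z w} → z ≈ w → conj z ≈ conj w
conj-cong {z} {w} (re≃ , im≃) = re≃ , negᴿ-cong {im z} {im w} im≃

+-assoc : ∀ z w u → z + w + u ≈ z + (w + u)
+-assoc z w u = ≈-pointwise (z + w + u) (z + (w + u))
  (λ n → ℚ.+-assoc (seq (re z) n) (seq (re w) n) (seq (re u) n))
  (λ n → ℚ.+-assoc (seq (im z) n) (seq (im w) n) (seq (im u) n))

+-comm : ∀ z w → z + w ≈ w + z
+-comm z w = ≈-pointwise (z + w) (w + z)
  (λ n → ℚ.+-comm (seq (re z) n) (seq (re w) n)) (λ n → ℚ.+-comm (seq (im z) n) (seq (im w) n))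

+-identityˡ : ∀ z → 0ℂ + z ≈ z
+-identityˡ z = ≈-pointwise (0ℂ + z) z
  (λ n → ℚ.+-identityˡ (seq (re z) n)) (λ n → ℚ.+-identityˡ (seq (im z) n))

+-identityʳ : ∀ z → z + 0ℂ ≈ z
+-identityʳ z = ≈-pointwise (z + 0ℂ) z
  (λ n → ℚ.+-identityʳ (seq (re z) n)) (λ n → ℚ.+-identityʳ (seq (im z) n))

-‿inverseˡ : ∀ z → - z + z ≈ 0ℂ
-‿inverseˡ z = ≈-pointwise (- z + z) 0ℂ
  (λ n → ℚ.+-inverseˡ (seq (re z) n)) (λ n → ℚ.+-inverseˡ (seq (im z) n))

-‿inverseʳ : ∀ z → z + - z ≈ 0ℂ
-‿inverseʳ z = ≈-pointwise (z + - z) 0ℂ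
  (λ n → ℚ.+-inverseʳ (seq (re z) n)) (λ n → ℚ.+-inverseʳ (seq (im z) n))

*-assoc : ∀ z w u → z * w * u ≈ z * (w * u)
*-assoc z w u = ≈-pointwise (z * w * u) (z * (w * u))
  (λ n → solve 6 (λ a b c d e f →
      (a :* c :- b :* d) :* e :- (a :* d :+ b :* c) :* f :=
      a :* (c :* e :- d :* f) :- b :* (c :* f :+ d :* e)) ≡.refl
    (seq (re z) n) (seq (im z) n) (seq (re w) n) (seq (im w) n) (seq (re u) n) (seq (im u) n))
  (λ n → solve 6 (λ a b c d e f →
      (a :* c :- b :* d) :* f :+ (a :* d :+ b :* c) :* e :=
      a :* (c :* f :+ d :* e) :+ b :* (c :* e :- d :* f)) ≡.refl
    (seq (re z) n) (seq (im z) n) (seq (re w) n) (seq (im w) n) (seq (re u) n) (seq (im u) n))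

*-comm : ∀ z w → z * w ≈ w * z
*-comm z w = ≈-pointwise (z * w) (w * z)
  (λ n → solve 4 (λ a b c d → a :* c :- b :* d := c :* a :- d :* b) ≡.refl
    (seq (re z) n) (seq (im z) n) (seq (re w) n) (seq (im w) n))
  (λ n → solve 4 (λ a b c d → a :* d :+ b :* c := c :* b :+ d :* a) ≡.refl
    (seq (re z) n) (seq (im z) n) (seq (re w) n) (seq (im w) n))

*-identityˡ : ∀ z → 1ℂ * z ≈ z
*-identityˡ z = ≈-pointwise (1ℂ * z) z
  (λ n → solve 2 (λ a b → con 1ℚ :* a :- con 0ℚ :* b := a) ≡.refl (seq (re z) n) (seq (im z) n))
  (λ n → solve 2 (λ a b → con 1ℚ :* b :+ con 0ℚ :* a := b) ≡.refl (seq (re z) n) (seq (im z) n))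

distribˡ : ∀ z w u → z * (w + u) ≈ z * w + z * u
distribˡ z w u = ≈-pointwise (z * (w + u)) (z * w + z * u)
  (λ n → solve 6 (λ a b c d e f →
      a :* (c :+ e) :- b :* (d :+ f) := (a :* c :- b :* d) :+ (a :* e :- b :* f)) ≡.refl
    (seq (re z) n) (seq (im z) n) (seq (re w) n) (seq (im w) n) (seq (re u) n) (seq (im u) n))
  (λ n → solve 6 (λ a b c d e f →
      a :* (d :+ f) :+ b :* (c :+ e) := (a :* d :+ b :* c) :+ (a :* f :+ b :* e)) ≡.refl
    (seq (re z) n) (seq (im z) n) (seq (re w) n) (seq (im w) n) (seq (re u) n) (seq (im u) n))

*-identityʳ : ∀ z → z * 1ℂ ≈ z
*-identityʳ z = ≈-trans {z * 1ℂ} {1ℂ * z} {z} (*-comm z 1ℂ) (*-identityˡ z)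

distribʳ : ∀ z w u → (w + u) * z ≈ w * z + u * z
distribʳ z w u = ≈-trans {(w + u) * z} {z * (w + u)} {w * z + u * z} (*-comm (w + u) z)
  (≈-trans {z * (w + u)} {z * w + z * u} {w * z + u * z} (distribˡ z w u)
    (+-cong {z * w} {w * z} {z * u} {u * z} (*-comm z w) (*-comm z u)))

ℂ-commutativeRing : CommutativeRing 0ℓ 0ℓ
ℂ-commutativeRing = record
  { Carrier = ℂ ; _≈_ = _≈_ ; _+_ = _+_ ; _*_ = _*_ ; -_ = -_ ; 0# = 0ℂ ; 1# = 1ℂ
  ; isCommutativeRing = record
    { isRing = record
      { +-isAbelianGroup = record
        { isGroup = record
          { isMonoid = record
            { isSemigroup = record
              { isMagma = record
                { isEquivalence = record
                  { refl  = λ {z} → ≈-refl {z}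
                  ; sym   = λ {z} {w} → ≈-sym {z} {w}
                  ; trans = λ {u} {z} {w} → ≈-trans {u} {z} {w} }
                ; ∙-cong = λ {z} {z′} {w} {w′} → +-cong {z} {z′} {w} {w′} }
              ; assoc = +-assoc }
            ; identity = +-identityˡ , +-identityʳ }
          ; inverse = -‿inverseˡ , -‿inverseʳ
          ; ⁻¹-cong = λ {z} {w} → -‿cong {z} {w} }
        ; comm = +-comm }
      ; *-cong = λ {z} {z′} {w} {w′} → *-cong {z} {z′} {w} {w′}
      ; *-assoc = *-assoc
      ; *-identity = *-identityˡ , *-identityʳ
      ; distrib = distribˡ , distribʳ }
    ; *-comm = *-comm } }

ℂ-starRing : StarRing 0ℓ 0ℓ
ℂ-starRing = record
  { commutativeRing = ℂ-commutativeRing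
  ; conj      = conj
  ; conj-cong = λ {z} {w} → conj-cong {z} {w}
  ; conj-+    = λ z w → ≈-pointwise (conj (z + w)) (conj z + conj w)
      (λ _ → ≡.refl) (λ n → ℚ.neg-distrib-+ (seq (im z) n) (seq (im w) n))
  ; conj-*    = λ z w → ≈-pointwise (conj (z * w)) (conj z * conj w)
      (λ n → solve 4 (λ a b c d → a :* c :- b :* d := a :* c :- (:- b) :* (:- d)) ≡.refl
        (seq (re z) n) (seq (im z) n) (seq (re w) n) (seq (im w) n))
      (λ n → solve 4 (λ a b c d → :- (a :* d :+ b :* c) := a :* (:- d) :+ (:- b) :* c) ≡.refl
        (seq (re z) n) (seq (im z) n) (seq (re w) n) (seq (im w) n))
  ; conj-0#   = ≈-pointwise (conj 0ℂ) 0ℂ (λ _ → ≡.refl) (λ _ → ≡.refl)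
  ; conj-involutive = λ z → ≈-pointwise (conj (conj z)) z
      (λ _ → ≡.refl) (λ n → solve 1 (λ b → :- :- b := b) ≡.refl (seq (im z) n))
  }

module F = Frames ℂ-starRing

-- Cancellation in ℂ

conj-*-self : ∀ z → re (conj z * z) ≃ ∣ z ∣²
conj-*-self z = ≃-pointwise (re (conj z * z)) ∣ z ∣²
  (λ n → solve 2 (λ a b → a :* a :- (:- b) :* b := a :* a :+ b :* b) ≡.refl (seq (re z) n) (seq (im z) n))

∣∣²≃0⇒≈0 : ∀ z → ∣ z ∣² ≃ 0ℝ → z ≈ 0ℂ
∣∣²≃0⇒≈0 z ∣z∣²≃0 =
  null⇒≃0 {re z} (null-sum-of-squares {seq (re z)} {seq (im z)} null) ,
  null⇒≃0 {im z} (null-sum-of-squares {seq (im z)} {seq (re z)}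
    (null-cong (λ n → ℚ.+-comm (seq (re z) n ℚ.* seq (re z) n) (seq (im z) n ℚ.* seq (im z) n)) null))
  where
  null : Null (seq ∣ z ∣²)
  null = ≃0⇒null {∣ z ∣²} ∣z∣²≃0

-- Since `conj z * z` is the real number |z|², it scales the real and imaginary parts of x
-- separately, and the real case applies to each.
ℂ-zeroOrCancellable : F.ZeroOrCancellable
ℂ-zeroOrCancellable z x z̄zx≈0 z≈0⇒x≈0 =
  *ᴿ-zero-or-cancellable ∣ z ∣² (re x)
    (≃-trans {∣ z ∣² *ᴿ re x} {re (conj z * z * x)} {0ℝ}
      (≃-pointwise (∣ z ∣² *ᴿ re x) (re (conj z * z * x)) (λ n → solve 4 (λ a b c d →
          (a :* a :+ b :* b) :* c :=
          (a :* a :- (:- b) :* b) :* c :- (a :* b :+ (:- b) :* a) :* d) ≡.refl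
        (seq (re z) n) (seq (im z) n) (seq (re x) n) (seq (im x) n)))
      (proj₁ z̄zx≈0))
    (λ ∣z∣²≃0 → proj₁ (z≈0⇒x≈0 (∣∣²≃0⇒≈0 z ∣z∣²≃0))) ,
  *ᴿ-zero-or-cancellable ∣ z ∣² (im x)
    (≃-trans {∣ z ∣² *ᴿ im x} {im (conj z * z * x)} {0ℝ}
      (≃-pointwise (∣ z ∣² *ᴿ im x) (im (conj z * z * x)) (λ n → solve 4 (λ a b c d →
          (a :* a :+ b :* b) :* d :=
          (a :* a :- (:- b) :* b) :* d :+ (a :* b :+ (:- b) :* a) :* c) ≡.refl
        (seq (re z) n) (seq (im z) n) (seq (re x) n) (seq (im x) n)))
      (proj₂ z̄zx≈0))
    (λ ∣z∣²≃0 → proj₂ (z≈0⇒x≈0 (∣∣²≃0⇒≈0 z ∣z∣²≃0)))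

open import Algebra.Definitions.RawMonoid (CommutativeRing.+-rawMonoid ℂ-commutativeRing)
  using () renaming (_×_ to _×ⁿ_)

fromℕ : ℕ → ℚ
fromℕ zero    = 0ℚ
fromℕ (suc m) = 1ℚ ℚ.+ fromℕ m

fromℕ-nonNegative : ∀ m → 0ℚ ℚ.≤ fromℕ m
fromℕ-nonNegative zero    = ℚ.≤-refl
fromℕ-nonNegative (suc m) = ℚ.+-mono-≤ (ℚ.<⇒≤ 0<1) (fromℕ-nonNegative m)

fromℕ-away : ∀ m → BoundedAway (λ _ → fromℕ (suc m))
fromℕ-away m = 1ℚ , 0<1 , 0 , λ _ _ →
  ℚ.≤-trans (ℚ.+-monoʳ-≤ 1ℚ (fromℕ-nonNegative m))
    (ℚ.≤-reflexive (≡.sym (ℚ.0≤p⇒∣p∣≡p (fromℕ-nonNegative (suc m)))))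

suc-* : ∀ a b → a ℚ.+ b ℚ.* a ≡ (1ℚ ℚ.+ b) ℚ.* a
suc-* a b = ≡.trans (≡.cong (ℚ._+ b ℚ.* a) (≡.sym (ℚ.*-identityˡ a))) (≡.sym (ℚ.*-distribʳ-+ a 1ℚ b))

re-×ⁿ : ∀ m z n → seq (re (m ×ⁿ z)) n ≡ fromℕ m ℚ.* seq (re z) n
re-×ⁿ zero    z n = ≡.sym (ℚ.*-zeroˡ (seq (re z) n))
re-×ⁿ (suc m) z n = ≡.trans (≡.cong (seq (re z) n ℚ.+_) (re-×ⁿ m z n)) (suc-* (seq (re z) n) (fromℕ m))

im-×ⁿ : ∀ m z n → seq (im (m ×ⁿ z)) n ≡ fromℕ m ℚ.* seq (im z) n
im-×ⁿ zero    z n = ≡.sym (ℚ.*-zeroˡ (seq (im z) n))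
im-×ⁿ (suc m) z n = ≡.trans (≡.cong (seq (im z) n ℚ.+_) (im-×ⁿ m z n)) (suc-* (seq (im z) n) (fromℕ m))

fromℕ-cancel : ∀ m x y → (∀ n → seq y n ≡ fromℕ (suc m) ℚ.* seq x n) → y ≃ 0ℝ → x ≃ 0ℝ
fromℕ-cancel m x y y≗mx y≃0 = null⇒≃0 {x} (null-cancel {seq x} (fromℕ-away m)
  (null-cong (λ n → ≡.trans (y≗mx n) (ℚ.*-comm (fromℕ (suc m)) (seq x n))) (≃0⇒null {y} y≃0)))

-- The multiple acts termwise as a rational factor that is at least 1, hence bounded away from 0.
ℂ-torsionFree : F.TorsionFree
ℂ-torsionFree m z (re≃0 , im≃0) =
  fromℕ-cancel m (re z) (re (suc m ×ⁿ z)) (re-×ⁿ (suc m) z) re≃0 ,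
  fromℕ-cancel m (im z) (im (suc m ×ⁿ z)) (im-×ⁿ (suc m) z) im≃0

-- Application to doubly transitive lines

module _ {n d} (ℓ : Fin n → Line d) (φ : Fin n → ℂ^ d) (φ∈ℓ : ∀ i → φ i ∈ˡ ℓ i)
         (unit : ∀ i → UnitNorm (φ i)) where

  opaque
    -- Unfolding identifies the inner products and matrix products of `F` with those of the theorem
    -- by computation.
    unfolding F.sum

    on-line : ∀ i u → u ∈ˡ ℓ i → u ≈ᵛ ⟨ φ i , u ⟩ ·ᵛ φ i
    on-line i u u∈ℓ =
      let b , _ , _ , spanning = Line.dim≡1 (ℓ i)
          p , φ≈pb = spanning (φ i) (φ∈ℓ i)
          q , u≈qb = spanning u u∈ℓ
      in F.collinear {b = b} {φ i} {u} {p} {q} φ≈pb u≈qb (unit i)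

    -- The span is an intersection of subspaces; this kernel is the subspace it is tested against.
    annihilator : ℂ^ d → Subspace d
    annihilator w = record
      { member   = λ u → sum (λ k → w k * u k) ≈ 0ℂ
      ; resp-≈   = λ {u} {v} → F.annihilates-resp w {u} {v}
      ; 0-closed = F.annihilates-0 w
      ; +-closed = λ {u} {v} → F.annihilates-+ w {u} {v}
      ; ·-closed = λ c {v} → F.annihilates-· w c {v}
      }

    -- A functional that vanishes on `φ i` vanishes on its line by `on-line`, hence on the whole
    -- span and on the standard basis.
    lines-span : SpanIsWholeSpace ℓ → F.Spans φ
    lines-span spans w w⊥φ = F.annihilates-basis⇒zero w λ l →
      spans (λ k → I k l) (annihilator w) λ i u u∈ℓ →
        F.annihilates-resp w {⟨ φ i , u ⟩ ·ᵛ φ i} {u}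
          (λ k → ≈-sym {u k} {⟨ φ i , u ⟩ * φ i k} (on-line i u u∈ℓ k))
          (F.annihilates-· w ⟨ φ i , u ⟩ {φ i} (w⊥φ i))

    gram-homogeneous : DoublyTransitive ℓ → F.TwoHomogeneous (F.gram φ)
    gram-homogeneous transitive x₁ x₂ y₁ y₂ x₁≢x₂ y₁≢y₂ =
      let σ , (Q , (Q†Q≈I , _) , Qℓ≐ℓσ) , σx₁≡y₁ , σx₂≡y₂ = transitive x₁ x₂ y₁ y₂ x₁≢x₂ y₁≢y₂
          -- Q maps `φ i` into the line of index σ i, where `on-line` gives this coefficient.
          ω = λ i → ⟨ φ (σ ⟨$⟩ʳ i) , Q *ᵐᵛ φ i ⟩
          isometry = F.⟪⟫-isometry Q Q†Q≈I
          Qφ≈ωφ = λ i → on-line (σ ⟨$⟩ʳ i) (Q *ᵐᵛ φ i)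
            (proj₁ (Qℓ≐ℓσ i) (φ i , φ∈ℓ i , λ k → ≈-refl {(Q *ᵐᵛ φ i) k}))
      in σ , ω , F.phase-unimodular {φ = φ} unit σ {Q} {ω} isometry Qφ≈ωφ ,
         F.gram-covariant {φ = φ} unit σ {Q} {ω} isometry Qφ≈ωφ , σx₁≡y₁ , σx₂≡y₂

    equiangular : DoublyTransitive ℓ → ∀ {i j p q} → i ≢ j → p ≢ q →
                  ∣ ⟨ φ i , φ j ⟩ ∣² ≃ ∣ ⟨ φ p , φ q ⟩ ∣²
    equiangular transitive {i} {j} {p} {q} i≢j p≢q =
      let z = ⟨ φ i , φ j ⟩
          w = ⟨ φ p , φ q ⟩
      in ≃-trans {∣ z ∣²} {re (conj z * z)} {∣ w ∣²} (≃-sym {re (conj z * z)} {∣ z ∣²} (conj-*-self z))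
        (≃-trans {re (conj z * z)} {re (conj w * w)} {∣ w ∣²}
          (proj₁ (F.gram-modulus-constant φ (gram-homogeneous transitive) i≢j p≢q)) (conj-*-self w))

    frame-tight : SpanIsWholeSpace ℓ → DoublyTransitive ℓ → n > d → ∀ {p q : Fin n} → p ≢ q →
                  ∀ k₀ → sumᵐ (λ i → outer (φ i)) ≈ᵐ sumᵐ (λ i → outer (φ i)) k₀ k₀ ·ᵐ I
    frame-tight spans transitive n>d p≢q =
      F.frame-scalar ℂ-torsionFree ℂ-zeroOrCancellable {φ = φ} (lines-span spans) unit
        (gram-homogeneous transitive) n>d p≢q

lemma1p1 : ∀ (n d : ℕ) (ℓ : Fin n → Line d) →
    SpanIsWholeSpace ℓ →
    DoublyTransitive ℓ →
    (φ : Fin n → ℂ^ d) →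
    (∀ i → φ i ∈ˡ ℓ i) →
    (∀ i → UnitNorm (φ i)) →
    (Σ ℝ λ β → ∀ (i j : Fin n) → i ≢ j → ∣ ⟨ φ i , φ j ⟩ ∣² ≃ β)
    × (n > d → Σ ℂ λ α → sumᵐ (λ i → outer (φ i)) ≈ᵐ α ·ᵐ I)
lemma1p1 0 d ℓ spans transitive φ φ∈ℓ unit = (0ℝ , λ ()) , λ ()
-- A single line has no distinct pair, so β defaults to 0; n > d forces d = 0, and the matrices have
-- no entries.
lemma1p1 1 d ℓ spans transitive φ φ∈ℓ unit =
  (0ℝ , λ { zero zero 0≢0 → contradiction ≡.refl 0≢0 }) , λ { (ℕ.s≤s ℕ.z≤n) → 0ℂ , λ () }
lemma1p1 (suc (suc n)) 0 ℓ spans transitive φ φ∈ℓ unit =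
  (∣ ⟨ φ zero , φ (suc zero) ⟩ ∣² , λ i j i≢j → equiangular ℓ φ φ∈ℓ unit transitive {p = zero} {suc zero} i≢j (λ ())) ,
  λ _ → 0ℂ , λ ()
-- The indices 0 and 1 are the reference pair p, q, and coordinate 0 serves as k₀.
lemma1p1 (suc (suc n)) (suc d) ℓ spans transitive φ φ∈ℓ unit =
  (∣ ⟨ φ zero , φ (suc zero) ⟩ ∣² , λ i j i≢j → equiangular ℓ φ φ∈ℓ unit transitive {p = zero} {suc zero} i≢j (λ ())) ,
  λ n>d → sumᵐ (λ i → outer (φ i)) zero zero ,
    frame-tight ℓ φ φ∈ℓ unit spans transitive n>d {zero} {suc zero} (λ ()) zero
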